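{- Let $G$ be a finite simple connected graph of odd order, let $f:V(G)\rightarrow \mathbb{Z}^+$ be an even integer-valued function with $f(v)\geq 4$ for all $v\in V(G)$, and let $H_f(v)=\{1,3,\ldots,f(v)-1,f(v)\}$ for $v\in V(G)$. Suppose that $d_G(v)\geq f(v)-1$ for all $v\in V(G)$. If $$o(G-S)\leq f(S)\qquad\text{for all } \emptyset\neq S\subseteq V(G),$$ then $G$ contains an $H_f$-factor.
   Context: For $S\subseteq V(G)$, $f(S)=\sum_{x\in S}f(x)$, and $o(G-S)$ denotes the number of components of odd order of $G-S$. For a set function $H$ assigning to each vertex $v$ a set $H(v)$ of integers, an $H$-factor of $G$ is a spanning subgraph $F$ of $G$ with $d_F(v)\in H(v)$ for every $v\in V(G)$. -}

module Defs where

open import Data.Nat using (ℕ; zero; suc; _+_; _∸_; _≤_; _<ᵇ_; _%_)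
open import Data.Bool using (Bool; true; false; _∧_; _∨_; not; if_then_else_)
open import Data.Fin using (Fin; toℕ; _≟_)
open import Data.Fin.Subset using (Subset; _∈_; Nonempty)
open import Data.Vec using (lookup)
open import Data.List using (List; map; allFin)
open import Data.Nat.ListAction using (sum)
open import Data.Bool.ListAction using (any; all)
open import Data.Product using (Σ; _×_)
open import Data.Sum using (_⊎_)
open import Relation.Nullary.Decidable using (⌊_⌋)
open import Relation.Binary.PropositionalEquality using (_≡_)

record Graph (n : ℕ) : Set where
  field
    adj  : Fin n → Fin n → Bool
    sym  : ∀ u v → adj u v ≡ adj v u
    irr  : ∀ v → adj v v ≡ false
open Graph public

countV : {n : ℕ} → (Fin n → Bool) → ℕ
countV {n} p = sum (map (λ u → if p u then 1 else 0) (allFin n))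

deg : {n : ℕ} → Graph n → Fin n → ℕ
deg G v = countV (λ u → adj G v u)

inS : {n : ℕ} → Subset n → Fin n → Bool
inS S x = lookup S x

fSum : {n : ℕ} → (Fin n → ℕ) → Subset n → ℕ
fSum {n} f S = sum (map (λ x → if inS S x then f x else 0) (allFin n))

reachK : {n : ℕ} → Graph n → Subset n → ℕ → Fin n → Fin n → Bool
reachK G S zero u v = not (inS S u) ∧ ⌊ u ≟ v ⌋
reachK {n} G S (suc k) u v =
  reachK G S k u v ∨
  any (λ w → reachK G S k u w ∧ adj G w v ∧ not (inS S v)) (allFin n)

-- u and v lie in the same component of G - S (walks of length ≤ n suffice)
sameComp : {n : ℕ} → Graph n → Subset n → Fin n → Fin n → Bool
sameComp {n} G S u v = reachK G S n u v

Connected : {n : ℕ} → Graph n → Set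
Connected {n} G = ∀ u v → sameComp G (Data.Fin.Subset.⊥) u v ≡ true

-- order of the component of G - S containing v (0 if v ∈ S)
compSize : {n : ℕ} → Graph n → Subset n → Fin n → ℕ
compSize G S v = countV (λ u → sameComp G S v u)

isOddℕ : ℕ → Bool
isOddℕ m = ⌊ m % 2 Data.Nat.≟ 1 ⌋

-- v is the representative (least-index vertex) of an odd component of G - S
oddRep : {n : ℕ} → Graph n → Subset n → Fin n → Bool
oddRep {n} G S v =
  not (inS S v) ∧
  all (λ u → not ((toℕ u <ᵇ toℕ v) ∧ sameComp G S u v)) (allFin n) ∧
  isOddℕ (compSize G S v)

oddComps : {n : ℕ} → Graph n → Subset n → ℕ
oddComps G S = countV (oddRep G S)

SpanningSub : {n : ℕ} → Graph n → Graph n → Set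
SpanningSub F G = ∀ u v → adj F u v ≡ true → adj G u v ≡ true

InHf : (fv d : ℕ) → Set
InHf fv d = (d % 2 ≡ 1 × d ≤ fv ∸ 1) ⊎ d ≡ fv

HfFactor : {n : ℕ} → Graph n → (Fin n → ℕ) → Graph n → Set
HfFactor G f F = SpanningSub F G × (∀ v → InHf (f v) (deg F v))

{-# OPTIONS --safe #-}
-- Call h : V → ℕ realisable if it is the degree sequence of a multigraph on G (loops allowed).
-- Reducing modulo 2 turns such a multigraph into a subgraph with degrees at most h and of the same
-- parities.  Start from h = f − 1, which is odd everywhere, and measure the deficiency: the least
-- number of units that must be dropped to reach a realisable prescription.  Let D be the set of
-- vertices that can be missed in an optimum and A the set of neighbours of D outside D.  As long as
-- some y in A has h(y) = f(y) − 1, raising h(y) to f(y) lowers the deficiency and forces y to have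
-- full degree f(y) from then on.  If the deficiency d > 0 persists with h = f on a non-empty A, the
-- Gallai–Edmonds stability lemma allows A to be deleted altogether; the d + f(A) vertices then
-- missed lie in distinct components of G − A, all odd, against o(G − A) ≤ f(A).  If A is empty then
-- D = V by connectivity, h = f − 1, and exactly one vertex x is missed.  There deg x ≤ f(x) − 2 <
-- deg_G x, so an unused edge xy can be added: it repairs x, and y either reaches f(y) or becomes the
-- new bad vertex.  The number of edges grows, so this stops with a factor.
module Submission where

open import Defs
open import Data.Bool as Bool using (Bool; true; false; _∧_; _∨_; _xor_; not; if_then_else_; T)
open import Data.Bool.Properties using (∨-comm; ∧-comm)
open import Data.Bool.ListAction using (any; all)
open import Data.Empty using (⊥)
open import Data.Fin using (Fin; zero; suc; toℕ; _≟_)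
import Data.Fin.Subset as Subset
open Subset using (Subset; Nonempty)
open import Data.Fin.Properties using (any?; all?; ¬∀⟶∃¬; suc-injective)
open import Data.List using (List; []; _∷_; _++_; map; allFin; tabulate; length; replicate)
open import Data.List.Membership.Propositional using (_∈_)
open import Data.List.Membership.Propositional.Properties using (∈-∃++; ∈-allFin)
open import Data.List.Properties using (map-tabulate; length-++; length-replicate; ++-identityʳ)
open import Data.List.Relation.Binary.Permutation.Propositional
  using (_↭_; refl; prep; swap; ↭-sym; ↭-trans)
open import Data.List.Relation.Binary.Permutation.Propositional.Properties
  using (shift; drop-∷; ↭-length; ++⁺ʳ; ++⁺ˡ; ∈-resp-↭)
open import Data.List.Relation.Binary.Pointwise using (Pointwise; []; _∷_; Pointwise-length)
open import Data.List.Relation.Unary.All as All using (All; []; _∷_)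
open import Data.List.Relation.Unary.All.Properties using (++⁺; replicate⁺)
open import Data.List.Relation.Unary.AllPairs using (AllPairs; []; _∷_)
open import Data.List.Relation.Unary.Any using (here; there)
open import Data.Nat using (ℕ; zero; suc; _+_; _*_; _∸_; _≤_; _<_; z≤n; s≤s; s≤s⁻¹; _<ᵇ_; _%_; _≤′_; ≤′-refl; ≤′-step)
open import Data.Nat.Divisibility
  using (_∣_; ∣m∣n⇒∣m+n; ∣m+n∣m⇒∣n; ∣⇒≤; m%n≡0⇒n∣m; m∣m*n; ∣-reflexive; _∣0)
open import Data.Nat.DivMod using (m%n<n)
open import Data.Nat.ListAction using (sum)
open import Data.Nat.Properties as ℕ hiding (_≟_; suc-injective)
open import Data.Nat.Tactic.RingSolver using (solve-∀)
import Data.Vec as Vec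
open import Data.Product using (Σ; ∃; ∃₂; _×_; _,_; proj₁; proj₂)
open import Data.Sum using (_⊎_; inj₁; inj₂; [_,_]′)
open import Data.Vec.Properties using (lookup∘tabulate; lookup⇒[]=)
open import Function using (_∘_; id)
open import Relation.Binary.PropositionalEquality as ≡
  using (_≡_; _≢_; refl; trans; cong; cong₂; subst)
open import Relation.Nullary using (¬_; Dec; yes; no; contradiction)
open import Relation.Nullary.Decidable using (⌊_⌋; map′; _×-dec_; _⊎-dec_; _→-dec_; ¬?)

-- Sums over the vertices and multiplicities in lists of vertices.

Σv : {n : ℕ} → (Fin n → ℕ) → ℕ
Σv {n} φ = sum (map φ (allFin n))

ι : Bool → ℕ
ι b = if b then 1 else 0

δ : {n : ℕ} → Fin n → Fin n → ℕ
δ u x = ι ⌊ u ≟ x ⌋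

-- Lists of vertices serve as multisets of missed units of degree: a vertex may occur several times
-- and the order is irrelevant.
cnt : {n : ℕ} → Fin n → List (Fin n) → ℕ
cnt x []      = 0
cnt x (u ∷ D) = δ u x + cnt x D

δ-refl : {n : ℕ} (u : Fin n) → δ u u ≡ 1
δ-refl u with u ≟ u
... | yes _  = refl
... | no u≢u = contradiction refl u≢u

δ-≢ : {n : ℕ} {u x : Fin n} → u ≢ x → δ u x ≡ 0
δ-≢ {u = u} {x} u≢x with u ≟ x
... | yes u≡x = contradiction u≡x u≢x
... | no _    = refl

Σv-suc : {n : ℕ} (φ : Fin (suc n) → ℕ) → Σv φ ≡ φ zero + Σv (φ ∘ suc)
Σv-suc {n} φ = cong (λ xs → φ zero + sum xs)
  (trans (map-tabulate suc φ) (≡.sym (map-tabulate id (φ ∘ suc))))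

Σv-cong : {n : ℕ} {φ ψ : Fin n → ℕ} → (∀ x → φ x ≡ ψ x) → Σv φ ≡ Σv ψ
Σv-cong {n} {φ} {ψ} eq = go (allFin n)
  where
  go : ∀ xs → sum (map φ xs) ≡ sum (map ψ xs)
  go []       = refl
  go (x ∷ xs) = cong₂ _+_ (eq x) (go xs)

Σv-mono : {n : ℕ} {φ ψ : Fin n → ℕ} → (∀ x → φ x ≤ ψ x) → Σv φ ≤ Σv ψ
Σv-mono {n} {φ} {ψ} le = go (allFin n)
  where
  go : ∀ xs → sum (map φ xs) ≤ sum (map ψ xs)
  go []       = z≤n
  go (x ∷ xs) = +-mono-≤ (le x) (go xs)

Σv-+ : {n : ℕ} (φ ψ : Fin n → ℕ) → Σv (λ x → φ x + ψ x) ≡ Σv φ + Σv ψ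
Σv-+ {n} φ ψ = go (allFin n)
  where
  interchange : ∀ a b c d → a + b + (c + d) ≡ a + c + (b + d)
  interchange = solve-∀

  go : ∀ xs → sum (map (λ x → φ x + ψ x) xs) ≡ sum (map φ xs) + sum (map ψ xs)
  go []       = refl
  go (x ∷ xs) = trans (cong (φ x + ψ x +_) (go xs))
                      (interchange (φ x) (ψ x) (sum (map φ xs)) (sum (map ψ xs)))

Σv-0 : {n : ℕ} {φ : Fin n → ℕ} → (∀ x → φ x ≡ 0) → Σv φ ≡ 0
Σv-0 {n} {φ} eq = go (allFin n)
  where
  go : ∀ xs → sum (map φ xs) ≡ 0
  go []       = refl
  go (x ∷ xs) = cong₂ _+_ (eq x) (go xs)

Σv-only : {n : ℕ} (u : Fin n) (φ : Fin n → ℕ) → (∀ x → u ≢ x → φ x ≡ 0) → Σv φ ≡ φ u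
Σv-only zero φ eq = trans (Σv-suc φ)
  (trans (cong (φ zero +_) (Σv-0 (λ x → eq (suc x) λ ()))) (+-identityʳ _))
Σv-only (suc u) φ eq = trans (Σv-suc φ)
  (cong₂ _+_ (eq zero λ ()) (Σv-only u (φ ∘ suc) (λ x u≢x → eq (suc x) (u≢x ∘ suc-injective))))

Σv-δ : {n : ℕ} (u : Fin n) → Σv (δ u) ≡ 1
Σv-δ u = trans (Σv-only u (δ u) (λ x → δ-≢)) (δ-refl u)

Σv-1 : {n : ℕ} → Σv {n} (λ _ → 1) ≡ n
Σv-1 {zero}  = refl
Σv-1 {suc n} = trans (Σv-suc {n} (λ _ → 1)) (cong suc Σv-1)

Σv-strict : {n : ℕ} {φ ψ : Fin n → ℕ} → (∀ x → φ x ≤ ψ x) → (u : Fin n) → φ u < ψ u → Σv φ < Σv ψ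
Σv-strict {n} {φ} {ψ} le u lt =
  subst (_≤ Σv ψ) (trans (Σv-+ (δ u) φ) (cong (_+ Σv φ) (Σv-δ u))) (Σv-mono bound)
  where
  bound : ∀ x → δ u x + φ x ≤ ψ x
  bound x with u ≟ x
  ... | yes refl = lt
  ... | no _     = le x

length≡Σv-cnt : {n : ℕ} (D : List (Fin n)) → length D ≡ Σv (λ x → cnt x D)
length≡Σv-cnt {n} [] = ≡.sym (Σv-0 {n} (λ _ → refl))
length≡Σv-cnt (u ∷ D) = ≡.sym (trans (Σv-+ (δ u) (λ x → cnt x D))
  (cong₂ _+_ (Σv-δ u) (≡.sym (length≡Σv-cnt D))))

cnt-++ : {n : ℕ} (x : Fin n) (C D : List (Fin n)) → cnt x (C ++ D) ≡ cnt x C + cnt x D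
cnt-++ x []      D = refl
cnt-++ x (u ∷ C) D = trans (cong (δ u x +_) (cnt-++ x C D)) (≡.sym (+-assoc (δ u x) _ _))

cnt-resp-↭ : {n : ℕ} (x : Fin n) {C D : List (Fin n)} → C ↭ D → cnt x C ≡ cnt x D
cnt-resp-↭ x refl = refl
cnt-resp-↭ x (prep u p) = cong (δ u x +_) (cnt-resp-↭ x p)
cnt-resp-↭ x (swap u v p) = trans (cong (λ c → δ u x + (δ v x + c)) (cnt-resp-↭ x p))
  (comm (δ u x) (δ v x) _)
  where
  comm : ∀ a b c → a + (b + c) ≡ b + (a + c)
  comm = solve-∀
cnt-resp-↭ x (_↭_.trans p q) = trans (cnt-resp-↭ x p) (cnt-resp-↭ x q)

cnt-fresh : {n : ℕ} {x : Fin n} {D : List (Fin n)} → All (x ≢_) D → cnt x D ≡ 0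
cnt-fresh []       = refl
cnt-fresh (p ∷ ps) = cong₂ _+_ (δ-≢ (p ∘ ≡.sym)) (cnt-fresh ps)

cnt≢0⇒∈ : {n : ℕ} {x : Fin n} (D : List (Fin n)) → cnt x D ≢ 0 → x ∈ D
cnt≢0⇒∈ []      c≢0 = contradiction refl c≢0
cnt≢0⇒∈ {x = x} (u ∷ D) c≢0 with u ≟ x
... | yes refl = here refl
... | no _     = there (cnt≢0⇒∈ D c≢0)

∈⇒↭ : {n : ℕ} {x : Fin n} {D : List (Fin n)} → x ∈ D → ∃ λ D′ → D ↭ x ∷ D′
∈⇒↭ {x = x} i with ys , zs , refl ← ∈-∃++ i = ys ++ zs , shift x ys zs

∈-split : {n : ℕ} (x : Fin n) (D : List (Fin n)) → cnt x D ≡ 0 ⊎ ∃ λ D′ → D ↭ x ∷ D′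
∈-split x D with cnt x D in eq
... | zero  = inj₁ refl
... | suc _ = inj₂ (∈⇒↭ (cnt≢0⇒∈ D (λ e → 1+n≢0 (trans (≡.sym eq) e))))

distinct≤countV : {n : ℕ} (p : Fin n → Bool) (D : List (Fin n)) →
  AllPairs _≢_ D → All (λ x → p x ≡ true) D → length D ≤ countV p
distinct≤countV p D distinct ps =
  subst (_≤ countV p) (≡.sym (length≡Σv-cnt D)) (Σv-mono (λ x → bound x D distinct ps))
  where
  bound : ∀ x D → AllPairs _≢_ D → All (λ x → p x ≡ true) D → cnt x D ≤ ι (p x)
  bound x [] _ _ = z≤n
  bound x (u ∷ D) (d ∷ ds) (q ∷ qs) with u ≟ x
  ... | yes refl rewrite q | cnt-fresh d = ≤-refl
  ... | no _     = bound x D ds qs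

-- Booleans and finite searches.

∨-true : (a : Bool) {b : Bool} → a ∨ b ≡ true → a ≡ true ⊎ b ≡ true
∨-true true  _  = inj₁ refl
∨-true false eq = inj₂ eq

∧-true : (a : Bool) {b : Bool} → a ∧ b ≡ true → a ≡ true × b ≡ true
∧-true true eq = refl , eq

∨-introʳ : (a : Bool) {b : Bool} → b ≡ true → a ∨ b ≡ true
∨-introʳ true  _  = refl
∨-introʳ false eq = eq

not-true : {b : Bool} → not b ≡ true → b ≡ false
not-true {false} _ = refl

any-elim : {A : Set} (p : A → Bool) (xs : List A) → any p xs ≡ true → ∃ λ x → p x ≡ true
any-elim p (x ∷ xs) eq with ∨-true (p x) eq
... | inj₁ px  = x , px
... | inj₂ pxs = any-elim p xs pxs

any-intro : {A : Set} (p : A → Bool) {x : A} {xs : List A} → x ∈ xs → p x ≡ true → any p xs ≡ true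
any-intro p (here refl)            px rewrite px = refl
any-intro p {xs = y ∷ _} (there i) px = ∨-introʳ (p y) (any-intro p i px)

all-intro : {A : Set} (p : A → Bool) (xs : List A) → (∀ x → p x ≡ true) → all p xs ≡ true
all-intro p []       h = refl
all-intro p (x ∷ xs) h rewrite h x = all-intro p xs h

≟-true : {n : ℕ} {u v : Fin n} → ⌊ u ≟ v ⌋ ≡ true → u ≡ v
≟-true {u = u} {v} eq with u ≟ v
... | yes u≡v = u≡v

≟-refl : {n : ℕ} (u : Fin n) → ⌊ u ≟ u ⌋ ≡ true
≟-refl u with u ≟ u
... | yes _  = refl
... | no u≢u = contradiction refl u≢u

ι-mono : {a b : Bool} → (a ≡ true → b ≡ true) → ι a ≤ ι b
ι-mono {false} f = z≤n
ι-mono {true}  f rewrite f refl = ≤-refl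

ι≤1 : (b : Bool) → ι b ≤ 1
ι≤1 true  = ≤-refl
ι≤1 false = z≤n

countV≤n : {n : ℕ} (p : Fin n → Bool) → countV p ≤ n
countV≤n p = ≤-trans (Σv-mono (λ x → ι≤1 (p x))) (≤-reflexive Σv-1)

-- Components of `G − S`.

module Components {n : ℕ} (G : Graph n) (S : Subset n) where

  -- Reachability without the length bound of `reachK`, so that symmetry and transitivity follow by
  -- induction.
  data Reach (u : Fin n) : Fin n → Set where
    here : inS S u ≡ false → Reach u u
    step : ∀ {w v} → Reach u w → adj G w v ≡ true → inS S v ≡ false → Reach u v

  start∉ : ∀ {u v} → Reach u v → inS S u ≡ false
  start∉ (here u∉)     = u∉
  start∉ (step r _ _) = start∉ r

  end∉ : ∀ {u v} → Reach u v → inS S v ≡ false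
  end∉ (here u∉)      = u∉
  end∉ (step _ _ v∉) = v∉

  Reach-trans : ∀ {u v w} → Reach u v → Reach v w → Reach u w
  Reach-trans r (here _)       = r
  Reach-trans r (step s e v∉) = step (Reach-trans r s) e v∉

  Reach-sym : ∀ {u v} → Reach u v → Reach v u
  Reach-sym (here u∉) = here u∉
  Reach-sym (step {w} {v} r e v∉) =
    Reach-trans (step (here v∉) (trans (Graph.sym G v w) e) (end∉ r)) (Reach-sym r)

  private
    R : ℕ → Fin n → Fin n → Bool
    R = reachK G S

  sound : ∀ k {u v} → R k u v ≡ true → Reach u v
  sound zero {u} eq with ∧-true (not (inS S u)) eq
  ... | u∉ , e with refl ← ≟-true e = here (not-true u∉)
  sound (suc k) {u} {v} eq with ∨-true (R k u v) eq
  ... | inj₁ r = sound k r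
  ... | inj₂ a with any-elim _ (allFin n) a
  ...   | w , e with ∧-true (R k u w) e
  ...     | r , e′ with ∧-true (adj G w v) e′
  ...       | a′ , v∉ = step (sound k r) a′ (not-true v∉)

  R-suc : ∀ k {u v} → R k u v ≡ true → R (suc k) u v ≡ true
  R-suc k eq rewrite eq = refl

  R-step : ∀ k {u w v} → R k u w ≡ true → adj G w v ≡ true → inS S v ≡ false → R (suc k) u v ≡ true
  R-step k {u} {w} {v} r e v∉ = ∨-introʳ (R k u v) (any-intro _ (∈-allFin w) body)
    where
    body : R k u w ∧ adj G w v ∧ not (inS S v) ≡ true
    body rewrite r | e | v∉ = refl

  Stable : ℕ → Fin n → Set
  Stable k u = ∀ v → R (suc k) u v ≡ true → R k u v ≡ true

  -- If one more round adds nothing, the set reached after `k` rounds is closed under steps.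
  stable-complete : ∀ k {u} → Stable k u → ∀ {v} → Reach u v → R k u v ≡ true
  stable-complete k {u} st (here u∉) = R-here k
    where
    R-here : ∀ k → R k u u ≡ true
    R-here zero rewrite u∉ = ≟-refl u
    R-here (suc k) = R-suc k (R-here k)
  stable-complete k st (step r e v∉) = st _ (R-step k (stable-complete k st r) e v∉)

  R-mono : ∀ {i k u v} → i ≤′ k → R i u v ≡ true → R k u v ≡ true
  R-mono ≤′-refl     eq = eq
  R-mono (≤′-step {k} i≤k) eq = R-suc k (R-mono i≤k eq)

  -- An unstable round reaches a new vertex, so after `k` of them more than `k` vertices are
  -- reached; for `k = n` only stability remains.
  stabilises : ∀ {u} → inS S u ≡ false → ∀ k → (∃ λ i → i ≤ k × Stable i u) ⊎ k < countV (R k u)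
  stabilises {u} u∉ zero = inj₂ (subst (_≤ countV (R 0 u)) (Σv-δ u)
    (Σv-mono {φ = δ u} {λ x → ι (R 0 u x)} λ x →
      ι-mono {⌊ u ≟ x ⌋} (λ e → cong₂ _∧_ (cong not u∉) e)))
  stabilises {u} u∉ (suc k) with stabilises u∉ k
  ... | inj₁ (i , i≤k , st) = inj₁ (i , m≤n⇒m≤1+n i≤k , st)
  ... | inj₂ k<c with all? (λ v → (R (suc k) u v Bool.≟ true) →-dec (R k u v Bool.≟ true))
  ...   | yes st = inj₁ (k , n≤1+n k , st)
  ...   | no ¬st with ¬∀⟶∃¬ n _ (λ v → (R (suc k) u v Bool.≟ true) →-dec (R k u v Bool.≟ true)) ¬st
  ...     | v , ¬imp = inj₂ (<-≤-trans (s≤s k<c) (Σv-strict (λ x → ι-mono (R-suc k {u} {x})) v jump))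
    where
    jump : ι (R k u v) < ι (R (suc k) u v)
    jump with R k u v | R (suc k) u v
    ... | true  | _     = contradiction (λ _ → refl) ¬imp
    ... | false | true  = ≤-refl
    ... | false | false = contradiction (λ ()) ¬imp

  complete : ∀ {u v} → Reach u v → sameComp G S u v ≡ true
  complete {u} r with stabilises (start∉ r) n
  ... | inj₁ (i , i≤n , st) = R-mono (≤⇒≤′ i≤n) (stable-complete i st r)
  ... | inj₂ n<c = contradiction (countV≤n (R n u)) (<⇒≱ n<c)

  sameComp⇒Reach : ∀ {u v} → sameComp G S u v ≡ true → Reach u v
  sameComp⇒Reach = sound n

  sameComp-cong : ∀ {u v} → Reach u v → ∀ w → sameComp G S u w ≡ sameComp G S v w
  sameComp-cong {u} {v} r w with sameComp G S u w in p | sameComp G S v w in q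
  ... | true  | true  = refl
  ... | false | false = refl
  ... | true  | false = trans (≡.sym (complete (Reach-trans (Reach-sym r) (sameComp⇒Reach p)))) q
  ... | false | true  = trans (≡.sym p) (complete (Reach-trans r (sameComp⇒Reach q)))

  compSize-cong : ∀ {u v} → Reach u v → compSize G S u ≡ compSize G S v
  compSize-cong r = Σv-cong (λ w → cong ι (sameComp-cong r w))

  -- Descent on the index: a vertex of smaller index in the same component replaces `v` until there
  -- is none.
  oddComponent-rep : ∀ v → inS S v ≡ false → isOddℕ (compSize G S v) ≡ true →
    ∃ λ r → Reach r v × oddRep G S r ≡ true
  oddComponent-rep v v∉ odd = go (suc (toℕ v)) v ≤-refl v∉ odd
    where
    go : ∀ k v → toℕ v < k → inS S v ≡ false → isOddℕ (compSize G S v) ≡ true →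
      ∃ λ r → Reach r v × oddRep G S r ≡ true
    go (suc k) v (s≤s v≤k) v∉ odd
      with any? (λ u → ((toℕ u <ᵇ toℕ v) ∧ sameComp G S u v) Bool.≟ true)
    ... | yes (u , e) with ∧-true (toℕ u <ᵇ toℕ v) e
    ...   | lt , c with r ← sameComp⇒Reach c
                   with go k u (<-≤-trans (<ᵇ⇒< (toℕ u) (toℕ v) (subst T (≡.sym lt) _)) v≤k) (start∉ r)
                          (trans (cong isOddℕ (compSize-cong r)) odd)
    ...     | q , s , rep = q , Reach-trans s r , rep
    go (suc k) v (s≤s v≤k) v∉ odd | no ¬smaller = v , here v∉ , rep
      where
      least : ∀ u → not ((toℕ u <ᵇ toℕ v) ∧ sameComp G S u v) ≡ true
      least u with (toℕ u <ᵇ toℕ v) ∧ sameComp G S u v in eq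
      ... | true  = contradiction (u , eq) ¬smaller
      ... | false = refl

      rep : oddRep G S v ≡ true
      rep rewrite v∉ | all-intro _ (allFin n) least = odd

  -- Each listed vertex is sent to the representative of its component; a shared representative
  -- would connect two of them.
  independent≤oddComps : (D : List (Fin n)) → AllPairs (λ u v → ¬ Reach u v) D →
    All (λ v → inS S v ≡ false × isOddℕ (compSize G S v) ≡ true) D → length D ≤ oddComps G S
  independent≤oddComps D ind odd with reps D odd
    where
    reps : ∀ D → All (λ v → inS S v ≡ false × isOddℕ (compSize G S v) ≡ true) D →
      ∃ λ Rs → Pointwise Reach Rs D × All (λ r → oddRep G S r ≡ true) Rs
    reps []      []              = [] , [] , []
    reps (v ∷ D) ((v∉ , o) ∷ os) with oddComponent-rep v v∉ o | reps D os
    ... | r , rv , rep | Rs , pw , reps′ = r ∷ Rs , rv ∷ pw , rep ∷ reps′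
  ... | Rs , pw , reps = subst (_≤ oddComps G S) (Pointwise-length pw)
                           (distinct≤countV (oddRep G S) Rs (distinct pw ind) reps)
    where
    fresh : ∀ {r v Rs D} → Reach r v → Pointwise Reach Rs D → All (λ u → ¬ Reach v u) D → All (r ≢_) Rs
    fresh rv []        []       = []
    fresh rv (su ∷ pw) (¬r ∷ a) =
      (λ { refl → ¬r (Reach-trans (Reach-sym rv) su) }) ∷ fresh rv pw a

    distinct : ∀ {Rs D} → Pointwise Reach Rs D → AllPairs (λ u v → ¬ Reach u v) D → AllPairs _≢_ Rs
    distinct []        []       = []
    distinct (rv ∷ pw) (a ∷ as) = fresh rv pw a ∷ distinct pw as

-- Multigraph realisations and alternating trails.

module Realization {n : ℕ} (G : Graph n) (f : Fin n → ℕ) where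

  V : Set
  V = Fin n

  -- Loops are admitted: they absorb pairs of parallel edges, so that only parities matter.
  Joined : V → V → Set
  Joined u v = u ≡ v ⊎ adj G u v ≡ true

  Joined-sym : ∀ {u v} → Joined u v → Joined v u
  Joined-sym (inj₁ eq)        = inj₁ (≡.sym eq)
  Joined-sym {u} {v} (inj₂ e) = inj₂ (trans (Graph.sym G v u) e)

  Joined? : ∀ u v → Dec (Joined u v)
  Joined? u v = (u ≟ v) ⊎-dec (adj G u v Bool.≟ true)

  record Edge : Set where
    constructor edge
    field
      {src dst} : V
      joined    : Joined src dst
  open Edge public

  edeg : V → List Edge → ℕ
  edeg x []      = 0
  edeg x (e ∷ E) = δ (src e) x + (δ (dst e) x + edeg x E)

  record Covers (t : V → ℕ) (E : List Edge) (D : List V) : Set where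
    constructor covers
    field at : ∀ x → edeg x E + cnt x D ≡ t x
  open Covers public

  -- N Q says that the degree prescription f − Q is realised by a multigraph on G.
  N : List V → Set
  N Q = ∃ λ E → Covers f E Q

  Covers-resp-↭ : ∀ {t E D D′} → D ↭ D′ → Covers t E D → Covers t E D′
  Covers-resp-↭ {E = E} p cov = covers λ x →
    trans (cong (edeg x E +_) (≡.sym (cnt-resp-↭ x p))) (at cov x)

  N-resp-↭ : ∀ {Q Q′} → Q ↭ Q′ → N Q → N Q′
  N-resp-↭ p (E , cov) = E , Covers-resp-↭ p cov

  front : ∀ D {y Q} → N (D ++ y ∷ Q) → N (y ∷ D ++ Q)
  front D {y} {Q} = N-resp-↭ (shift y D Q)

  inside : ∀ D {y Q} → N (y ∷ D ++ Q) → N (D ++ y ∷ Q)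
  inside D {y} {Q} = N-resp-↭ (↭-sym (shift y D Q))

  N-swap : ∀ {u v Q} → N (u ∷ v ∷ Q) → N (v ∷ u ∷ Q)
  N-swap = N-resp-↭ (swap _ _ refl)

  N-prefix : ∀ {D D′ Q} → D ↭ D′ → N (D ++ Q) → N (D′ ++ Q)
  N-prefix {Q = Q} p = N-resp-↭ (++⁺ʳ Q p)

  -- An added edge `uv` covers one missed unit at each end.
  join : ∀ {u v Q} → Joined u v → N (u ∷ v ∷ Q) → N Q
  join {u} {v} {Q} uv (E , cov) =
    edge uv ∷ E , covers λ x → trans (assoc (δ u x) (δ v x) (edeg x E) (cnt x Q)) (at cov x)
    where
    assoc : ∀ a b e q → a + (b + e) + q ≡ e + (a + (b + q))
    assoc = solve-∀

  split : ∀ y E → edeg y E ≢ 0 → ∃ λ z → Joined y z × ∃ λ E′ →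
    length E ≡ suc (length E′) × (∀ x → edeg x E ≡ δ y x + (δ z x + edeg x E′))
  split y [] e≢0 = contradiction refl e≢0
  split y (edge {u} {v} uv ∷ E) e≢0 with u ≟ y | v ≟ y
  ... | yes refl | _        = v , uv , E , refl , λ _ → refl
  ... | no _     | yes refl = u , Joined-sym uv , E , refl , λ x → comm (δ u x) (δ v x) (edeg x E)
    where
    comm : ∀ a b c → a + (b + c) ≡ b + (a + c)
    comm = solve-∀
  ... | no _     | no _ with split y E e≢0
  ...   | z , yz , E′ , len , eq = z , yz , edge uv ∷ E′ , cong suc len ,
          λ x → trans (cong (λ e → δ u x + (δ v x + e)) (eq x))
                      (rearr (δ u x) (δ v x) (δ y x) (δ z x) (edeg x E′))
    where
    rearr : ∀ a b c d e → a + (b + (c + (d + e))) ≡ c + (d + (a + (b + e)))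
    rearr = solve-∀

  -- Reverse of `join`: `Q` does not use up the prescription at `y`, so some edge sits at `y`, and
  -- dropping it leaves both its ends missed.
  release : ∀ y {Q} → cnt y Q < f y → N Q → ∃ λ z → N (y ∷ z ∷ Q)
  release y {Q} lt (E , cov)
    with split y E (λ e → <-irrefl (trans (cong (_+ cnt y Q) (≡.sym e)) (at cov y)) lt)
  ... | z , _ , E′ , _ , eq = z , E′ , covers λ x →
        trans (rearr (edeg x E′) (δ y x) (δ z x) (cnt x Q))
              (trans (cong (_+ cnt x Q) (≡.sym (eq x))) (at cov x))
    where
    rearr : ∀ e a b q → e + (a + (b + q)) ≡ a + (b + e) + q
    rearr = solve-∀

  -- The two possible ends `w` of the trail. If `w` lies in `D`, the coverings trade `y` for `w`; if
  -- `w` lies in `C`, the first covering misses two units fewer and the second two more.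
  data Switched (t : V → ℕ) (y : V) (C D : List V) : Set where
    transfer : ∀ {w D′} → D ↭ w ∷ D′ →
      ∀ {E F} → Covers t E (w ∷ C) → Covers t F (y ∷ D′) → Switched t y C D
    augment  : ∀ {w C′} → C ↭ w ∷ C′ →
      ∀ {E F} → Covers t E C′ → Covers t F (y ∷ w ∷ D) → Switched t y C D

  -- Both coverings satisfy the same degree prescription t, except that the first misses y as well.
  -- Follow the alternating trail from y and switch along it; it ends where a missed vertex is met.
  switch : ∀ k {t y E C F D} → length E + length F ≤ k →
    Covers t E (y ∷ C) → Covers t F D → Switched t y C D
  switch k {t} {y} {E} {C} {F} {D} len covE covF with ∈-split y D
  -- The empty trail: `y` itself is missed by `F`.
  ... | inj₂ (D′ , p) =
        transfer p covE (Covers-resp-↭ p covF)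
  -- Comparing the two coverings at `y` shows that `F` has an edge there.
  ... | inj₁ none with split y F (λ e → 1+n≢0 (trans (≡.sym (at-y (edeg y E) (cnt y C)))
                    (trans (cong (λ d → edeg y E + (d + cnt y C)) (≡.sym (δ-refl y)))
                    (trans (at covE y) (trans (≡.sym (at covF y)) (cong₂ _+_ e none))))))
    where
    at-y : ∀ a b → a + (1 + b) ≡ 1 + (a + b)
    at-y = solve-∀
  ...   | z , yz , F′ , lenF , eq = continue k len
    where
    -- One unit at `y` is taken off `t`: `E` forgets the missed `y`, while `F` loses the edge `yz`
    -- and now misses `z`. The trail goes on from `z` with the roles of `E` and `F` exchanged.
    t′ : V → ℕ
    t′ x = edeg x E + cnt x C

    δ+t′ : ∀ x → δ y x + t′ x ≡ t x
    δ+t′ x = trans (rearr (δ y x) (edeg x E) (cnt x C)) (at covE x)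
      where
      rearr : ∀ a b c → a + (b + c) ≡ b + (a + c)
      rearr = solve-∀

    covF′ : Covers t′ F′ (z ∷ D)
    covF′ = covers λ x → +-cancelˡ-≡ (δ y x) _ _
      (trans (rearr (δ y x) (δ z x) (edeg x F′) (cnt x D))
      (trans (cong (_+ cnt x D) (≡.sym (eq x)))
      (trans (at covF x) (≡.sym (δ+t′ x)))))
      where
      rearr : ∀ a b c d → a + (c + (b + d)) ≡ a + (b + c) + d
      rearr = solve-∀

    withEdge : ∀ {H B} → Covers t′ H (z ∷ B) → Covers t (edge yz ∷ H) B
    withEdge {H} {B} cov = covers λ x → trans (rearr (δ y x) (δ z x) (edeg x H) (cnt x B))
                               (trans (cong (δ y x +_) (at cov x)) (δ+t′ x))
      where
      rearr : ∀ a b c d → a + (b + c) + d ≡ a + (c + (b + d))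
      rearr = solve-∀

    missing : ∀ {H B} → Covers t′ H B → Covers t H (y ∷ B)
    missing {H} {B} cov = covers λ x → trans (rearr (δ y x) (edeg x H) (cnt x B))
                              (trans (cong (δ y x +_) (at cov x)) (δ+t′ x))
      where
      rearr : ∀ a b c → b + (a + c) ≡ a + (b + c)
      rearr = solve-∀

    continue : ∀ k → length E + length F ≤ k → Switched t y C D
    continue zero le = contradiction
      (trans (≡.sym lenF) (m+n≡0⇒n≡0 (length E) (n≤0⇒n≡0 le))) λ ()
    continue (suc k) le with switch k {t′} {z} {F′} {D} {E} {C} le′ covF′ (covers λ _ → refl)
      where
      le′ : length F′ + length E ≤ k
      le′ = s≤s⁻¹ (subst (_≤ suc k) (trans (cong (length E +_) lenF)
              (trans (+-suc (length E) _) (cong suc (+-comm (length E) _)))) le)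
    -- The exchange of roles also exchanges the two kinds of end.
    ... | transfer p covF″ covE″ = augment p (withEdge covE″) (missing covF″)
    ... | augment p covF″ covE″  = transfer p (withEdge covE″) (missing covF″)

  -- This is `switch` for the prescription `f − Q`, written as what `F` and `D` add up to in order
  -- to avoid subtraction; `Q` stays missed throughout.
  exchange : ∀ {v} C D {Q} → N (v ∷ C ++ Q) → N (D ++ Q) →
    (∃₂ λ w D′ → D ↭ w ∷ D′ × N (w ∷ C ++ Q) × N (v ∷ D′ ++ Q)) ⊎
    (∃₂ λ w C′ → C ↭ w ∷ C′ × N (C′ ++ Q))
  exchange {v} C D {Q} (E , covE) (F , covF)
    with switch _ {λ x → edeg x F + cnt x D} {v} {E} {C} {F} {D} ≤-refl covE′ (covers λ _ → refl)
    where
    covE′ : Covers (λ x → edeg x F + cnt x D) E (v ∷ C)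
    covE′ = covers λ x → +-cancelʳ-≡ (cnt x Q) _ _
      (trans (+-assoc (edeg x E) _ _) (trans (cong (edeg x E +_) (≡.sym (cnt-++ x (v ∷ C) Q)))
      (trans (at covE x) (trans (≡.sym (at covF x)) (trans (cong (edeg x F +_) (cnt-++ x D Q))
      (≡.sym (+-assoc (edeg x F) _ _)))))))
  ... | result = conclude result
    where
    extend : ∀ {H} B → Covers (λ x → edeg x F + cnt x D) H B → N (B ++ Q)
    extend {H} B cov = H , covers λ x →
      trans (cong (edeg x H +_) (cnt-++ x B Q)) (trans (≡.sym (+-assoc (edeg x H) _ _))
      (trans (cong (_+ cnt x Q) (at cov x)) (trans (+-assoc (edeg x F) _ _)
      (trans (cong (edeg x F +_) (≡.sym (cnt-++ x D Q))) (at covF x)))))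

    conclude : Switched (λ x → edeg x F + cnt x D) v C D → _
    conclude (transfer p cov₁ cov₂) = inj₁ (_ , _ , p , extend _ cov₁ , extend _ cov₂)
    conclude (augment p cov₁ _)     = inj₂ (_ , _ , p , extend _ cov₁)

  -- Bounds the edges of any realisation by the sum of `f`, which makes `N` decidable by a finite
  -- search.
  length≤Σv-edeg : ∀ E → length E ≤ Σv (λ x → edeg x E)
  length≤Σv-edeg []      = z≤n
  length≤Σv-edeg (e ∷ E) = subst (suc (length E) ≤_)
    (≡.sym (trans (Σv-+ (δ (src e)) _) (cong (_+ Σv (λ x → δ (dst e) x + edeg x E)) (Σv-δ (src e)))))
    (s≤s (≤-trans (length≤Σv-edeg E) (Σv-mono (λ x → m≤n+m _ (δ (dst e) x)))))

  N≤ : ℕ → List V → Set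
  N≤ k Q = ∃ λ E → length E ≤ k × Covers f E Q

  N≤? : ∀ k Q → Dec (N≤ k Q)
  N≤? zero Q = map′ (λ eq → [] , z≤n , covers eq) (λ { ([] , _ , cov) → at cov }) (all? (λ x → cnt x Q ℕ.≟ f x))
  N≤? (suc k) Q = map′ to from
    (all? (λ x → cnt x Q ℕ.≟ f x) ⊎-dec
     any? (λ u → any? (λ v → Joined? u v ×-dec N≤? k (u ∷ v ∷ Q))))
    where
    assoc : ∀ a b e q → e + (a + (b + q)) ≡ a + (b + e) + q
    assoc = solve-∀

    Stop Go : Set
    Stop = ∀ x → cnt x Q ≡ f x
    Go   = ∃ λ u → ∃ λ v → Joined u v × N≤ k (u ∷ v ∷ Q)

    to : Stop ⊎ Go → N≤ (suc k) Q
    to (inj₁ eq) = [] , z≤n , covers eq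
    to (inj₂ (u , v , uv , E , le , cov)) = edge uv ∷ E , s≤s le ,
      covers λ x → trans (≡.sym (assoc (δ u x) (δ v x) (edeg x E) (cnt x Q))) (at cov x)

    from : N≤ (suc k) Q → Stop ⊎ Go
    from ([] , _ , cov) = inj₁ (at cov)
    from (edge {u} {v} uv ∷ E , s≤s le , cov) = inj₂ (u , v , uv , E , le ,
      covers λ x → trans (assoc (δ u x) (δ v x) (edeg x E) (cnt x Q)) (at cov x))

  N? : ∀ Q → Dec (N Q)
  N? Q = map′ (λ { (E , _ , cov) → E , cov })
              (λ { (E , cov) → E , ≤-trans (length≤Σv-edeg E)
                     (Σv-mono (λ x → subst (edeg x E ≤_) (at cov x) (m≤m+n _ _))) , cov })
              (N≤? (Σv f) Q)

  Misses : ℕ → List V → Set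
  Misses d Q = ∃ λ D → length D ≡ d × N (D ++ Q)

  Misses? : ∀ d Q → Dec (Misses d Q)
  Misses? zero Q = map′ (λ q → [] , refl , q) (λ { ([] , _ , q) → q }) (N? Q)
  Misses? (suc d) Q = map′
    (λ { (x , D , len , q) → x ∷ D , cong suc len , front D q })
    (λ { (x ∷ D , len , q) → x , D , ℕ.suc-injective len , inside D q })
    (any? (λ x → Misses? d (x ∷ Q)))

  -- `d` is the deficiency of the prescription `f − Q`.
  Opt : List V → ℕ → Set
  Opt Q d = Misses d Q × (∀ {d′} → d′ < d → ¬ Misses d′ Q)

  Opt-exists : ∀ {d Q} → Misses d Q → ∃ λ d′ → Opt Q d′
  Opt-exists {d} {Q} m with search (suc d)
    where
    search : ∀ k → (∃ λ d′ → Opt Q d′) ⊎ (∀ {d′} → d′ < k → ¬ Misses d′ Q)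
    search zero = inj₂ λ ()
    search (suc k) with search k
    ... | inj₁ found = inj₁ found
    ... | inj₂ none with Misses? k Q
    ...   | yes mk = inj₁ (k , mk , none)
    ...   | no ¬mk = inj₂ (λ { (s≤s le) mk → [ (λ lt → none lt mk) , (λ { refl → ¬mk mk }) ]′ (m≤n⇒m<n∨m≡n le) })
  ... | inj₁ found = found
  ... | inj₂ none  = contradiction m (none ≤-refl)

  -- If `y` is missed already, one copy of it moves from `D` into the fixed part; otherwise
  -- `release` costs one extra missed unit.
  displace : ∀ y D {Q} → cnt y Q < f y → N (D ++ Q) → ∃ λ D′ → length D′ ≤ suc (length D) × N (D′ ++ y ∷ Q)
  displace y D {Q} lt q with ∈-split y D
  ... | inj₂ (D′ , p) = D′ , ≤-trans (n≤1+n _) (≤-trans (≤-reflexive (≡.sym (↭-length p))) (n≤1+n _)) ,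
                        inside D′ (N-prefix p q)
  ... | inj₁ none with release y (subst (_< f y) (≡.sym (trans (cnt-++ y D Q) (cong (_+ cnt y Q) none))) lt) q
  ...   | z , q′ = z ∷ D , ≤-refl , inside (z ∷ D) q′

-- Gallai's lemma and the stability lemma.

module GallaiEdmonds {n : ℕ} (G : Graph n) (f : Fin n → ℕ) where

  open Realization G f public

  -- The set D of the Gallai–Edmonds decomposition when suc j vertices are missed.
  Missable : ℕ → List V → V → Set
  Missable j Q x = Misses j (x ∷ Q)

  -- Two of the `suc j` missed units of one optimum.
  Both : ℕ → List V → V → V → Set
  Both j Q u w = ∃ λ D → suc (length D) ≡ j × N (u ∷ w ∷ D ++ Q)

  module _ {Q : List V} {j : ℕ} (opt : Opt Q (suc j)) where

    minimal : ∀ D → N (D ++ Q) → suc j ≤ length D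
    minimal D q = ≮⇒≥ (λ lt → proj₂ opt lt (D , refl , q))

    shorter : ∀ D → length D ≤ j → ¬ N (D ++ Q)
    shorter D le q = 1+n≰n (≤-trans (minimal D q) le)

    -- `exchange` brings `v` into the optimum that misses `u` and `w`, and a single vertex leaves
    -- it. If that is `u`, then `w` remains beside `v`; otherwise `u` does. The augmenting case
    -- contradicts optimality.
    Both-shift : ∀ {u v w} → Both j Q u w → Missable j Q v → Both j Q u v ⊎ Both j Q v w
    Both-shift {u} {v} {w} (D , len , q) (C , lenC , q′)
      with exchange C (u ∷ w ∷ D) (front C q′) q
    ... | inj₂ (z , C′ , p , s) =
          contradiction s (shorter C′ (≤-trans (n≤1+n _) (≤-reflexive (trans (≡.sym (↭-length p)) lenC))))
    ... | inj₁ (z , D′ , p , _ , s) with z ≟ u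
    ...   | yes refl = inj₂ (D , len , N-prefix (prep v (drop-∷ (↭-sym p))) s)
    ...   | no z≢u with ∈-resp-↭ p (here refl)
    ...     | here u≡z = contradiction (≡.sym u≡z) z≢u
    ...     | there u∈D′ with D″ , p′ ← ∈⇒↭ u∈D′ =
              inj₁ (D″ , trans (≡.sym (↭-length p′)) (trans (≡.sym (ℕ.suc-injective (↭-length p))) len) ,
                    N-swap (N-prefix (prep v p′) s))

    Both-joined : ∀ {u w} → Joined u w → ¬ Both j Q u w
    Both-joined uw (D , len , q) = shorter D (≤-trans (n≤1+n _) (≤-reflexive len)) (join uw q)

    module _ (S : Subset n)
             (closed : ∀ {u w} → Missable j Q u → adj G u w ≡ true → inS S w ≡ false → Missable j Q w)
      where

      open Components G S

      Missable-Reach : ∀ {u w} → Missable j Q u → Reach u w → Missable j Q w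
      Missable-Reach u∈ (here _)       = u∈
      Missable-Reach u∈ (step r e w∉) = closed (Missable-Reach u∈ r) e w∉

      -- Gallai's lemma: by Both-shift, “not both missable” is transitive on the missable vertices,
      -- and by Both-joined it contains adjacency.
      Both-Reach : ∀ {u w} → Missable j Q u → Reach u w → ¬ Both j Q u w
      Both-Reach u∈ (here _) = Both-joined (inj₁ refl)
      Both-Reach u∈ (step r e _) b with Both-shift b (Missable-Reach u∈ r)
      ... | inj₁ b′ = Both-Reach u∈ r b′
      ... | inj₂ b′ = Both-joined (inj₂ e) b′

    missed : ∀ {y} D → length D ≡ suc j → N (D ++ Q) → y ∈ D → Missable j Q y
    missed D len q y∈ with D′ , p ← ∈⇒↭ y∈ =
      D′ , ℕ.suc-injective (trans (≡.sym (↭-length p)) len) , inside D′ (N-prefix p q)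

    -- The stability lemma: a vertex of A may be deleted one unit at a time.
    module Stability {y z : V} (y∉ : ¬ Missable j Q y) (yz : adj G y z ≡ true)
                     (z∈ : Missable j Q z) (spare : cnt y Q < f y) where

      private
        C : List V
        C = proj₁ z∈

        lenC : length C ≡ j
        lenC = proj₁ (proj₂ z∈)

        missC : N (z ∷ C ++ Q)
        missC = front C (proj₂ (proj₂ z∈))

        release-y : ∀ D → length D ≡ suc j → N (D ++ Q) → ∃ λ w → N (y ∷ w ∷ D ++ Q)
        release-y D len q with ∈-split y D
        ... | inj₂ (D′ , p) = contradiction (missed D len q (∈-resp-↭ (↭-sym p) (here refl))) y∉
        ... | inj₁ none = release y (subst (_< f y) (≡.sym (trans (cnt-++ y D Q) (cong (_+ cnt y Q) none))) spare) q

      -- No optimum misses `y`, so an edge at `y` can be released; `y` joins `Q` and the other end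
      -- is the extra missed unit.
      Missable⁺ : ∀ {x} → Missable j Q x → Missable (suc j) (y ∷ Q) x
      Missable⁺ {x} (D , len , q) with release-y (x ∷ D) (cong suc len) (front D q)
      ... | w , q′ = w ∷ D , cong suc len ,
            inside (w ∷ D) (inside (x ∷ w ∷ D) (N-resp-↭ (prep y (swap w x refl)) q′))

      -- `z` is exchanged into the realisation that misses `y` and `x`. If `y` leaves, `y` is
      -- missable, which is excluded; if `x` leaves, `x` is missable. Otherwise `z`, `y` and `x` are
      -- missed together, and adding the edge `yz` leaves an optimum that misses `x`.
      Missable⁻ : ∀ {x} → Missable (suc j) (y ∷ Q) x → Missable j Q x
      Missable⁻ {x} (D , len , q)
        with exchange C (y ∷ x ∷ D) missC (front (x ∷ D) (front D q))
      ... | inj₂ (_ , C′ , p , s) =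
            contradiction s (shorter C′ (≤-trans (n≤1+n _) (≤-reflexive (trans (≡.sym (↭-length p)) lenC))))
      ... | inj₁ (w , D′ , p , s , t) with w ≟ y | w ≟ x
      ...   | yes refl | _        = contradiction (C , lenC , inside C s) y∉
      ...   | no _     | yes refl = C , lenC , inside C s
      ...   | no w≢y   | no w≢x with ∈-resp-↭ p (here refl)
      ...     | here y≡w = contradiction (≡.sym y≡w) w≢y
      ...     | there y∈ with D″ , p′ ← ∈⇒↭ y∈ with ∈-resp-↭ (drop-∷ (↭-trans p (↭-trans (prep w p′) (swap w y refl)))) (here refl)
      ...       | here x≡w = contradiction (≡.sym x≡w) w≢x
      ...       | there x∈ with D‴ , p″ ← ∈⇒↭ x∈ =
                  D‴ , ℕ.suc-injective (ℕ.suc-injective (trans (≡.sym lenD) (cong suc len))) ,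
                  inside D‴ (N-prefix p″ (join (inj₂ (trans (Graph.sym G z y) yz)) (N-prefix (prep z p′) t)))
                where
                lenD : suc (length D) ≡ suc (suc (length D‴))
                lenD = ℕ.suc-injective (trans (↭-length p) (cong suc (trans (↭-length p′) (cong suc (↭-length p″)))))

      -- With `y` counted as missed, a cheaper solution misses `suc j` or `suc (suc j)` units in
      -- all. In the first case `y` is missable; in the second, `exchange` with an optimum makes `y`
      -- missable or beats the optimum.
      Opt⁺ : Opt (y ∷ Q) (suc (suc j))
      Opt⁺ = exists , least
        where
        exists : Misses (suc (suc j)) (y ∷ Q)
        exists with release-y (z ∷ C) (cong suc lenC) missC
        ... | w , q = w ∷ z ∷ C , cong (2 +_) lenC , inside (w ∷ z ∷ C) q

        least : ∀ {d} → d < suc (suc j) → ¬ Misses d (y ∷ Q)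
        least (s≤s d≤) (D , refl , q) with m≤n⇒m<n∨m≡n d≤
        ... | inj₁ lt = y∉ (D , ≤-antisym (s≤s⁻¹ lt) (s≤s⁻¹ (minimal (y ∷ D) (front D q))) , q)
        ... | inj₂ eq with exchange D (z ∷ C) (front D q) missC
        ...   | inj₁ (_ , D′ , p , _ , s) =
                y∉ (D′ , trans (≡.sym (ℕ.suc-injective (↭-length p))) lenC , inside D′ s)
        ...   | inj₂ (_ , D′ , p , s) =
                shorter D′ (≤-reflexive (ℕ.suc-injective (trans (≡.sym (↭-length p)) eq))) s

  record SameMissable (j : ℕ) (Q : List V) (i : ℕ) (P : List V) : Set where
    field
      to   : ∀ {x} → Missable j Q x → Missable i P x
      from : ∀ {x} → Missable i P x → Missable j Q x
  open SameMissable public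

  -- A vertex of the set A of the Gallai–Edmonds decomposition.
  Boundary : ℕ → List V → V → Set
  Boundary j Q y = ¬ Missable j Q y × ∃ λ z → adj G y z ≡ true × Missable j Q z

  Boundary? : ∀ j Q y → Dec (Boundary j Q y)
  Boundary? j Q y = ¬? (Misses? j (y ∷ Q)) ×-dec
    any? (λ z → (adj G y z Bool.≟ true) ×-dec Misses? j (z ∷ Q))

  -- Induction by the stability lemma. The missable set never changes, so the remaining vertices
  -- stay in the boundary; `ys` may repeat a vertex as long as its prescription has room.
  delete : ∀ {j Q} → Opt Q (suc j) → ∀ ys → All (Boundary j Q) ys → (∀ x → cnt x (ys ++ Q) ≤ f x) →
    ∃₂ λ i P → i ≡ length ys + j × Opt P (suc i) × SameMissable j Q i P ×
               (∀ x → cnt x P ≡ cnt x ys + cnt x Q)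
  delete {j} {Q} opt [] [] _ = j , Q , refl , opt , record { to = id ; from = id } , λ _ → refl
  delete {j} {Q} opt (y ∷ ys) ((y∉ , z , yz , z∈) ∷ bs) room
    = conclude (delete Stab.Opt⁺ ys (All.map boundary bs) room′)
    where
    spare : cnt y Q < f y
    spare = <-≤-trans (subst (λ c → cnt y Q < c + cnt y (ys ++ Q)) (≡.sym (δ-refl y))
      (s≤s (subst (cnt y Q ≤_) (≡.sym (cnt-++ y ys Q)) (m≤n+m _ _)))) (room y)

    module Stab = Stability opt y∉ yz z∈ spare

    boundary : ∀ {u} → Boundary j Q u → Boundary (suc j) (y ∷ Q) u
    boundary (u∉ , w , uw , w∈) = u∉ ∘ Stab.Missable⁻ , w , uw , Stab.Missable⁺ w∈

    room′ : ∀ x → cnt x (ys ++ y ∷ Q) ≤ f x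
    room′ x = subst (_≤ f x) (≡.sym (cnt-resp-↭ x (shift y ys Q))) (room x)

    rearr : ∀ a b c → a + (b + c) ≡ b + a + c
    rearr = solve-∀

    conclude : _ → _
    conclude (i , P , i≡ , optP , same , cntP) = i , P , trans i≡ (+-suc (length ys) j) , optP ,
      record { to = to same ∘ Stab.Missable⁺ ; from = Stab.Missable⁻ ∘ from same } ,
      λ x → trans (cntP x) (rearr (cnt x ys) (δ y x) (cnt x Q))

-- Sums over a set of vertices, lists with given multiplicities, and parity.

Σv-∣ : {n k : ℕ} {φ : Fin n → ℕ} → (∀ x → k ∣ φ x) → k ∣ Σv φ
Σv-∣ {n} {k} {φ} div = go (allFin n)
  where
  go : ∀ xs → k ∣ sum (map φ xs)
  go []       = k ∣0
  go (x ∷ xs) = ∣m∣n⇒∣m+n (div x) (go xs)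

Σv[_]_ : {n : ℕ} → (Fin n → Bool) → (Fin n → ℕ) → ℕ
Σv[ p ] φ = Σv (λ x → if p x then φ x else 0)

module _ {n : ℕ} (p : Fin n → Bool) where

  Σv[]-+ : (φ ψ : Fin n → ℕ) → Σv[ p ] (λ x → φ x + ψ x) ≡ Σv[ p ] φ + Σv[ p ] ψ
  Σv[]-+ φ ψ = trans (Σv-cong eq) (Σv-+ (λ x → if p x then φ x else 0) _)
    where
    eq : ∀ x → (if p x then φ x + ψ x else 0) ≡ (if p x then φ x else 0) + (if p x then ψ x else 0)
    eq x with p x
    ... | true  = refl
    ... | false = refl

  Σv[]-cong : {φ ψ : Fin n → ℕ} → (∀ x → p x ≡ true → φ x ≡ ψ x) → Σv[ p ] φ ≡ Σv[ p ] ψ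
  Σv[]-cong {φ} {ψ} eq = Σv-cong eq′
    where
    eq′ : ∀ x → (if p x then φ x else 0) ≡ (if p x then ψ x else 0)
    eq′ x with p x in px
    ... | true  = eq x px
    ... | false = refl

  Σv[]-0 : {φ : Fin n → ℕ} → (∀ x → p x ≡ true → φ x ≡ 0) → Σv[ p ] φ ≡ 0
  Σv[]-0 {φ} eq = trans (Σv[]-cong {φ} {λ _ → 0} eq) (Σv-0 zeros)
    where
    zeros : ∀ x → (if p x then 0 else 0) ≡ 0
    zeros x with p x
    ... | true  = refl
    ... | false = refl

  Σv[]-δ : (u : Fin n) → Σv[ p ] (δ u) ≡ ι (p u)
  Σv[]-δ u = trans (Σv-only u _ off) on
    where
    off : ∀ x → u ≢ x → (if p x then δ u x else 0) ≡ 0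
    off x u≢x with p x
    ... | true  = δ-≢ u≢x
    ... | false = refl

    on : (if p u then δ u u else 0) ≡ ι (p u)
    on with p u
    ... | true  = δ-refl u
    ... | false = refl

  Σv[]-∣ : {k : ℕ} {φ : Fin n → ℕ} → (∀ x → k ∣ φ x) → k ∣ Σv[ p ] φ
  Σv[]-∣ {k} {φ} div = Σv-∣ div′
    where
    div′ : ∀ x → k ∣ (if p x then φ x else 0)
    div′ x with p x
    ... | true  = div x
    ... | false = k ∣0

spread : {n : ℕ} → (Fin n → ℕ) → List (Fin n) → List (Fin n)
spread φ []       = []
spread φ (x ∷ xs) = replicate (φ x) x ++ spread φ xs

length-spread : {n : ℕ} (φ : Fin n → ℕ) (xs : List (Fin n)) → length (spread φ xs) ≡ sum (map φ xs)
length-spread φ []       = refl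
length-spread φ (x ∷ xs) = trans (length-++ (replicate (φ x) x))
  (cong₂ _+_ (length-replicate (φ x)) (length-spread φ xs))

All-spread : {n : ℕ} {B : Fin n → Set} (φ : Fin n → ℕ) → (∀ x → φ x ≢ 0 → B x) → ∀ xs → All B (spread φ xs)
All-spread φ h []       = []
All-spread {B = B} φ h (x ∷ xs) = ++⁺ copies (All-spread φ h xs)
  where
  copies : All B (replicate (φ x) x)
  copies with φ x | h x
  ... | zero  | _  = []
  ... | suc k | hx = replicate⁺ (suc k) (hx λ ())

cnt-spread : {n : ℕ} (φ : Fin n → ℕ) (x : Fin n) → cnt x (spread φ (allFin n)) ≡ φ x
cnt-spread {n} φ x = trans (go (allFin n)) (trans (Σv-only x _ off) on)
  where
  copies : ∀ k u → cnt x (replicate k u) ≡ k * δ u x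
  copies zero    u = refl
  copies (suc k) u = cong (δ u x +_) (copies k u)

  go : ∀ xs → cnt x (spread φ xs) ≡ sum (map (λ u → φ u * δ u x) xs)
  go []       = refl
  go (u ∷ us) = trans (cnt-++ x (replicate (φ u) u) _) (cong₂ _+_ (copies (φ u) u) (go us))

  off : ∀ u → x ≢ u → φ u * δ u x ≡ 0
  off u x≢u = trans (cong (φ u *_) (δ-≢ (x≢u ∘ ≡.sym))) (*-zeroʳ (φ u))

  on : φ x * δ x x ≡ φ x
  on = trans (cong (φ x *_) (δ-refl x)) (*-identityʳ (φ x))

spread-1 : {n : ℕ} (xs : List (Fin n)) → spread (λ _ → 1) xs ≡ xs
spread-1 []       = refl
spread-1 (x ∷ xs) = cong (x ∷_) (spread-1 xs)

cnt-allFin : {n : ℕ} (x : Fin n) → cnt x (allFin n) ≡ 1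
cnt-allFin {n} x = trans (cong (cnt x) (≡.sym (spread-1 (allFin n)))) (cnt-spread (λ _ → 1) x)

even-suc⇒odd : ∀ {m} → 2 ∣ suc m → m % 2 ≡ 1
even-suc⇒odd {m} 2∣1+m with m % 2 in eq | m%n<n m 2
... | suc zero    | _ = refl
... | suc (suc _) | s≤s (s≤s ())
... | zero        | _ =
  contradiction (∣⇒≤ (∣m+n∣m⇒∣n (subst (2 ∣_) (+-comm 1 m) 2∣1+m) (m%n≡0⇒n∣m m 2 eq))) λ { (s≤s ()) }

even-suc⇒isOdd : ∀ m → 2 ∣ suc m → isOddℕ m ≡ true
even-suc⇒isOdd m 2∣1+m with m % 2 ℕ.≟ 1
... | yes _  = refl
... | no m≢1 = contradiction (even-suc⇒odd 2∣1+m) m≢1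

-- Missed vertices and odd components.

module Deficiency {n : ℕ} (G : Graph n) (f : Fin n → ℕ)
                  (f-even : ∀ v → 2 ∣ f v) (1<f : ∀ v → 1 < f v) where

  open GallaiEdmonds G f public

  module _ {Q : List V} {j : ℕ} (opt : Opt Q (suc j)) (S : Subset n)
           (closed : ∀ {u w} → Missable j Q u → adj G u w ≡ true → inS S w ≡ false → Missable j Q w)
           (missable∉S : ∀ {u} → Missable j Q u → inS S u ≡ false)
           (exhausted : ∀ {a} → inS S a ≡ true → f a ≤ cnt a Q)
           (single : ∀ {u} → Missable j Q u → cnt u Q ≡ 1) where

    open Components G S

    private
      D : List V
      D = proj₁ (proj₁ opt)

      lenD : length D ≡ suc j
      lenD = proj₁ (proj₂ (proj₁ opt))

      missD : N (D ++ Q)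
      missD = proj₂ (proj₂ (proj₁ opt))

      E : List Edge
      E = proj₁ missD

      -- `Q` already takes the whole prescription at `a`, so no edge is left there.
      avoidsS : ∀ {a} → inS S a ≡ true → edeg a E ≡ 0
      avoidsS {a} a∈ = n≤0⇒n≡0 (+-cancelʳ-≤ (cnt a (D ++ Q)) _ 0
        (subst (_≤ cnt a (D ++ Q)) (≡.sym (at (proj₂ missD) a))
          (≤-trans (exhausted a∈) (subst (cnt a Q ≤_) (≡.sym (cnt-++ a D Q)) (m≤n+m _ _)))))

      unreachable : ∀ {u w C} → Missable j Q u → length (u ∷ w ∷ C) ≡ suc j → N (u ∷ w ∷ C ++ Q) → ¬ Reach u w
      unreachable u∈ len q r = Both-Reach opt S closed u∈ r (_ , ℕ.suc-injective len , q)

      module _ (v : V) where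

        inC : V → Bool
        inC = sameComp G S v

        inC-edge : ∀ {u w} → Joined u w → inS S u ≡ false → inS S w ≡ false → inC u ≡ inC w
        inC-edge (inj₁ refl) _ _ = refl
        inC-edge {u} {w} (inj₂ e) u∉ w∉ with inC u in p | inC w in q
        ... | true  | true  = refl
        ... | false | false = refl
        ... | true  | false = trans (≡.sym (complete (step (sameComp⇒Reach p) e w∉))) q
        ... | false | true  =
          trans (≡.sym p) (complete (step (sameComp⇒Reach q) (trans (Graph.sym G w u) e) u∉))

        -- An edge that avoids `S` has both ends in the component of `v` or neither, and so
        -- contributes 2 or 0.
        even-edeg : ∀ E → (∀ {a} → inS S a ≡ true → edeg a E ≡ 0) → 2 ∣ Σv[ inC ] (λ x → edeg x E)
        even-edeg [] _ = subst (2 ∣_) (≡.sym (Σv[]-0 inC (λ _ _ → refl))) (2 ∣0)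
        even-edeg (edge {u} {w} uw ∷ E) av = subst (2 ∣_) (≡.sym decompose)
          (∣m∣n⇒∣m+n even-ends (even-edeg E (λ {a} a∈ → m+n≡0⇒n≡0 (δ w a) (m+n≡0⇒n≡0 (δ u a) (av a∈)))))
          where
          decompose : Σv[ inC ] (λ x → δ u x + (δ w x + edeg x E)) ≡
                      ι (inC u) + ι (inC w) + Σv[ inC ] (λ x → edeg x E)
          decompose = trans (Σv[]-+ inC (δ u) _)
            (trans (cong₂ _+_ (Σv[]-δ inC u) (trans (Σv[]-+ inC (δ w) _) (cong (_+ _) (Σv[]-δ inC w))))
                   (≡.sym (+-assoc (ι (inC u)) _ _)))

          u∉ : inS S u ≡ false
          u∉ with inS S u in u∈
          ... | false = refl
          ... | true = contradiction (trans (≡.sym (δ-refl u)) (m+n≡0⇒m≡0 (δ u u) (av u∈))) 1+n≢0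

          w∉ : inS S w ≡ false
          w∉ with inS S w in w∈
          ... | false = refl
          ... | true = contradiction
            (trans (≡.sym (δ-refl w)) (m+n≡0⇒m≡0 (δ w w) (m+n≡0⇒n≡0 (δ u w) (av w∈)))) 1+n≢0

          even-ends : 2 ∣ ι (inC u) + ι (inC w)
          even-ends rewrite inC-edge uw u∉ w∉ with inC w
          ... | true  = ∣-reflexive refl
          ... | false = 2 ∣0

      -- Summing `f` over the component `C` of `v` gives an even number. The edges contribute an
      -- even part, `Q` one unit per vertex of `C`, and `D` only the unit at `v`; hence `1 + |C|` is
      -- even.
      odd-component : ∀ {v D′} → D ↭ v ∷ D′ → isOddℕ (compSize G S v) ≡ true
      odd-component {v} {D′} p = even-suc⇒isOdd _
        (∣m+n∣m⇒∣n (subst (2 ∣_) total (Σv[]-∣ (inC v) f-even)) (even-edeg v E avoidsS))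
        where
        v∈ : Missable j Q v
        v∈ = missed opt D lenD missD (∈-resp-↭ (↭-sym p) (here refl))

        once : ∀ x → inC v x ≡ true → cnt x D′ ≡ 0
        once x x∈C with ∈-split x D′
        ... | inj₁ none = none
        ... | inj₂ (D″ , p′) = contradiction (sameComp⇒Reach x∈C)
          (unreachable v∈ (trans (≡.sym (↭-length (↭-trans p (prep v p′)))) lenD)
                          (N-prefix (↭-trans p (prep v p′)) missD))

        v∈C : inC v v ≡ true
        v∈C = complete (here (missable∉S v∈))

        ones : Σv[ inC v ] (λ x → cnt x D + cnt x Q) ≡ suc (compSize G S v)
        ones = trans (Σv[]-cong (inC v) {ψ = λ x → δ v x + 1} pointwise)
          (trans (Σv[]-+ (inC v) (δ v) (λ _ → 1))
                 (cong (_+ compSize G S v) (trans (Σv[]-δ (inC v) v) (cong ι v∈C))))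
          where
          pointwise : ∀ x → inC v x ≡ true → cnt x D + cnt x Q ≡ δ v x + 1
          pointwise x x∈C = cong₂ _+_
            (trans (cnt-resp-↭ x p) (trans (cong (δ v x +_) (once x x∈C)) (+-identityʳ _)))
            (single (Missable-Reach opt S closed v∈ (sameComp⇒Reach x∈C)))

        total : Σv[ inC v ] f ≡ Σv[ inC v ] (λ x → edeg x E) + suc (compSize G S v)
        total = trans (Σv[]-cong (inC v) (λ x _ → trans (≡.sym (at (proj₂ missD) x))
                                                  (cong (edeg x E +_) (cnt-++ x D Q))))
                (trans (Σv[]-+ (inC v) (λ x → edeg x E) _) (cong (Σv[ inC v ] (λ x → edeg x E) +_) ones))

      -- `B` holds the vertices already treated, so that `C ++ B` remains the full list of an
      -- optimum.
      separated : ∀ C B → length (C ++ B) ≡ suc j → N ((C ++ B) ++ Q) → AllPairs (λ u w → ¬ Reach u w) C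
      separated [] B len q = []
      separated (u ∷ C) B len q =
        All.tabulate (λ {w} w∈ → let C′ , p = ∈⇒↭ w∈ ; p′ = prep u (++⁺ʳ B p) in
          unreachable (missed opt _ len q (here refl)) (trans (≡.sym (↭-length p′)) len) (N-prefix p′ q))
        ∷ separated C (u ∷ B) (trans (↭-length (shift u C B)) len) (N-prefix (↭-sym (shift u C B)) q)

    -- By Gallai's lemma the missed vertices lie in pairwise different components of `G − S`, and
    -- each of these is odd.
    deficiency≤oddComps : suc j ≤ oddComps G S
    deficiency≤oddComps = subst (_≤ oddComps G S) lenD (independent≤oddComps D
      (separated D [] (trans (cong length (++-identityʳ D)) lenD)
                      (subst (λ C → N (C ++ Q)) (≡.sym (++-identityʳ D)) missD))
      (All.tabulate λ v∈ → missable∉S (missed opt D lenD missD v∈) , odd-component (proj₂ (∈⇒↭ v∈))))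

  -- Raising the prescription from `f − 1` to `f`.

  module Completion (connected : Connected G) (tough : ∀ S → Nonempty S → oddComps G S ≤ fSum f S) where

    0<f : ∀ v → 0 < f v
    0<f v = <-trans (s≤s z≤n) (1<f v)

    -- The vertices outside P have prescription f, those in P have f − 1; Saturated says that
    -- the former have full degree in every near-optimal realisation.
    Saturated : ℕ → List V → Set
    Saturated j P = ∀ {x} → cnt x P ≡ 0 → ∀ D → length D ≤ suc j → ¬ N (x ∷ x ∷ D ++ P)

    -- `full` is deficiency zero, with full degree forced outside `P`; `near` is the prescription
    -- `f − 1` everywhere with the single missed vertex `x`.
    data Outcome : Set where
      full  : ∀ {P} → N P → (∀ x → cnt x P ≤ 1) → (∀ {x} → cnt x P ≡ 0 → ¬ N (x ∷ x ∷ P)) → Outcome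
      near  : ∀ {x P} → N (x ∷ P) → (∀ y → cnt y P ≡ 1) → Outcome

    module _ {j : ℕ} {P : List V} (opt : Opt P (suc j)) (cnt≤1 : ∀ x → cnt x P ≤ 1)
             (sat : Saturated (suc j) P) where

      -- A missable vertex outside `P` could be missed twice, either because `D` contains it again
      -- or by releasing another of its edges, against saturation.
      Missable⇒∈ : ∀ {x} → Missable j P x → cnt x P ≡ 1
      Missable⇒∈ {x} (D , len , q) with cnt x P in eq | cnt≤1 x
      ... | suc zero    | _ = refl
      ... | suc (suc _) | s≤s ()
      ... | zero        | _ with ∈-split x D
      ...   | inj₂ (D′ , p) = contradiction (N-prefix (prep x p) (front D q))
              (sat eq D′ (≤-trans (n≤1+n _) (≤-trans (≤-reflexive (trans (≡.sym (↭-length p)) len)) (m≤n+m j 2))))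
      ...   | inj₁ none with release x {x ∷ D ++ P} (subst (_< f x) (≡.sym count) (1<f x)) (front D q)
        where
        count : cnt x (x ∷ D ++ P) ≡ 1
        count = cong₂ _+_ (δ-refl x) (trans (cnt-++ x D P) (cong₂ _+_ none eq))
      ...     | z , q′ = contradiction (N-resp-↭ (prep x (swap z x refl)) q′)
                           (sat eq (z ∷ D) (s≤s (≤-trans (≤-reflexive len) (n≤1+n j))))

      -- Raise a boundary vertex y to f y: one vertex fewer is missed, and y becomes saturated.
      module Raise {y : V} (b : Boundary j P y) {P′ : List V} (p : P ↭ y ∷ P′) where

        private
          z : V
          z = proj₁ (proj₂ b)

          yz : adj G y z ≡ true
          yz = proj₁ (proj₂ (proj₂ b))

          z∈ : Missable j P z
          z∈ = proj₂ (proj₂ (proj₂ b))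

          module Stab = Stability opt (proj₁ b) yz z∈ (≤-<-trans (cnt≤1 y) (1<f y))

          cnt-P : ∀ x → cnt x P ≡ δ y x + cnt x P′
          cnt-P x = cnt-resp-↭ x p

          y∉P′ : cnt y P′ ≡ 0
          y∉P′ = n≤0⇒n≡0 (+-cancelˡ-≤ 1 _ 0 (subst (_≤ 1) (trans (cnt-P y) (cong (_+ cnt y P′) (δ-refl y))) (cnt≤1 y)))

          extract : ∀ D → N (D ++ P) → N (y ∷ D ++ P′)
          extract D q = front D (N-resp-↭ (++⁺ˡ D p) q)

          insert : ∀ D → N (D ++ y ∷ P′) → N (D ++ P)
          insert D = N-resp-↭ (++⁺ˡ D (↭-sym p))

        -- Once `y` leaves `P` it counts as missed, and the edge `yz` covers it together with the
        -- missed `z`. Conversely, `displace` returns `y` to `P` at the cost of at most one unit.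
        opt′ : Opt P′ j
        opt′ = (proj₁ z∈ , proj₁ (proj₂ z∈) ,
                join (inj₂ yz) (extract (z ∷ proj₁ z∈) (front (proj₁ z∈) (proj₂ (proj₂ z∈))))) , least
          where
          least : ∀ {d} → d < j → ¬ Misses d P′
          least d<j (D , refl , q) with displace y D (subst (_< f y) (≡.sym y∉P′) (0<f y)) q
          ... | D′ , le , q′ = shorter opt D′ (≤-trans le d<j) (insert D′ q′)

        cnt≤1′ : ∀ x → cnt x P′ ≤ 1
        cnt≤1′ x = ≤-trans (m≤n+m _ (δ y x)) (subst (_≤ 1) (cnt-P x) (cnt≤1 x))

        -- For `x = y` one copy of `y` is put back into `P`, and `Opt⁺` forbids so few missed units.
        -- For other `x`, returning `y` to `P` costs at most one unit, which the slack in
        -- `Saturated` allows.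
        saturated′ : Saturated j P′
        saturated′ {x} x∉P′ D le q with x ≟ y
        ... | yes refl = proj₂ Stab.Opt⁺ (s≤s le)
                (D , refl , inside D (insert (x ∷ D) (inside (x ∷ D) q)))
        ... | no x≢y
            with displace y D {x ∷ x ∷ P′} (subst (_< f y) (≡.sym y∉Q) (0<f y)) (inside D (inside (x ∷ D) q))
          where
          y∉Q : cnt y (x ∷ x ∷ P′) ≡ 0
          y∉Q = cong₂ _+_ (δ-≢ x≢y) (cong₂ _+_ (δ-≢ x≢y) y∉P′)
        ...   | D′ , le′ , q′ =
                sat (trans (cnt-P x) (cong₂ _+_ (δ-≢ (x≢y ∘ ≡.sym)) x∉P′)) D′ (≤-trans le′ (s≤s le))
                  (insert (x ∷ x ∷ D′) (inside (x ∷ x ∷ D′) (front-past D′ q′)))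
          where
          front-past : ∀ D′ → N (D′ ++ y ∷ x ∷ x ∷ P′) → N (y ∷ x ∷ x ∷ D′ ++ P′)
          front-past D′ q = N-resp-↭ (prep y (↭-trans (shift x D′ (x ∷ P′)) (prep x (shift x D′ P′)))) (front D′ q)

      module _ (raised : ∀ {y} → Boundary j P y → cnt y P ≡ 0) where

        boundarySet : Subset n
        boundarySet = Vec.tabulate (λ y → ⌊ Boundary? j P y ⌋)

        inS-boundary : ∀ y → inS boundarySet y ≡ ⌊ Boundary? j P y ⌋
        inS-boundary = lookup∘tabulate (λ y → ⌊ Boundary? j P y ⌋)

        inS⇒Boundary : ∀ {y} → inS boundarySet y ≡ true → Boundary j P y
        inS⇒Boundary {y} y∈ with Boundary? j P y | trans (≡.sym (inS-boundary y)) y∈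
        ... | yes b | _ = b

        Boundary⇒inS : ∀ {y} → Boundary j P y → inS boundarySet y ≡ true
        Boundary⇒inS {y} b with Boundary? j P y | inS-boundary y
        ... | yes _ | eq = eq
        ... | no ¬b | _  = contradiction b ¬b

        closed : ∀ {u w} → Missable j P u → adj G u w ≡ true → ¬ Boundary j P w → Missable j P w
        closed {u} {w} u∈ e ¬b with Misses? j (w ∷ P)
        ... | yes w∈ = w∈
        ... | no w∉ = contradiction (w∉ , u , trans (Graph.sym G w u) e , u∈) ¬b

        -- All `f` units of each boundary vertex are deleted. The deficiency becomes
        -- `suc (f(A) + j)`, yet it is at most the number of odd components, hence at most `f(A)`.
        impossible : ∀ {y} → Boundary j P y → ⊥
        impossible {y} b = conclude (delete opt copies (All-spread φ in-boundary (allFin n)) room)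
          where
          φ : V → ℕ
          φ x = if inS boundarySet x then f x else 0

          copies : List V
          copies = spread φ (allFin n)

          in-boundary : ∀ x → φ x ≢ 0 → Boundary j P x
          in-boundary x φ≢0 with inS boundarySet x in x∈
          ... | true  = inS⇒Boundary x∈
          ... | false = contradiction refl φ≢0

          room : ∀ x → cnt x (copies ++ P) ≤ f x
          room x = subst (_≤ f x) (≡.sym (trans (cnt-++ x copies P) (cong (_+ cnt x P) (cnt-spread φ x)))) bound
            where
            bound : φ x + cnt x P ≤ f x
            bound with inS boundarySet x in x∈
            ... | true  = ≤-reflexive (trans (cong (f x +_) (raised (inS⇒Boundary x∈))) (+-identityʳ _))
            ... | false = ≤-trans (cnt≤1 x) (0<f x)

          conclude : (∃₂ λ i Q → i ≡ length copies + j × Opt Q (suc i) × SameMissable j P i Q ×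
                      (∀ x → cnt x Q ≡ cnt x copies + cnt x P)) → ⊥
          conclude (i , Q , refl , optQ , same , cntQ) = 1+n≰n (≤-trans
            (≤-trans (deficiency≤oddComps optQ boundarySet
                       (λ u∈ e w∉ → to same (closed (from same u∈) e (λ b′ → outside w∉ b′)))
                       missable∉S exhausted single)
                     (tough boundarySet (y , lookup⇒[]= y boundarySet (Boundary⇒inS b))))
            (≤-trans (≤-reflexive (≡.sym (length-spread φ (allFin n)))) (m≤m+n _ j)))
            where
            outside : ∀ {w} → inS boundarySet w ≡ false → ¬ Boundary j P w
            outside w∉ b′ with () ← trans (≡.sym w∉) (Boundary⇒inS b′)

            missable∉S : ∀ {u} → Missable i Q u → inS boundarySet u ≡ false
            missable∉S {u} u∈ with inS boundarySet u in eq
            ... | false = refl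
            ... | true  = contradiction (from same u∈) (proj₁ (inS⇒Boundary eq))

            φ-in : ∀ {a} → inS boundarySet a ≡ true → φ a ≡ f a
            φ-in a∈ rewrite a∈ = refl

            φ-out : ∀ {a} → inS boundarySet a ≡ false → φ a ≡ 0
            φ-out a∉ rewrite a∉ = refl

            exhausted : ∀ {a} → inS boundarySet a ≡ true → f a ≤ cnt a Q
            exhausted {a} a∈ = subst (f a ≤_)
              (≡.sym (trans (cntQ a) (cong (_+ cnt a P) (trans (cnt-spread φ a) (φ-in a∈))))) (m≤m+n _ _)

            single : ∀ {u} → Missable i Q u → cnt u Q ≡ 1
            single {u} u∈ = trans (cntQ u)
              (cong₂ _+_ (trans (cnt-spread φ u) (φ-out (missable∉S u∈))) (Missable⇒∈ (from same u∈)))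

        -- With no boundary the missable set is closed under adjacency, so by connectivity it is
        -- everything, and Gallai's lemma on the whole of `G` allows only one missed unit.
        everywhere : Outcome
        everywhere with proj₁ opt
        ... | [] , () , _
        ... | v ∷ [] , refl , q = near q λ y → Missable⇒∈ (missable y)
          where
          missable : ∀ y → Missable j P y
          missable y = Missable-Reach opt Subset.⊥ (λ u∈ e _ → closed u∈ e impossible) ([] , refl , q)
            (Components.sameComp⇒Reach G Subset.⊥ (connected v y))
        ... | v ∷ w ∷ D , len , q = contradiction (D , ℕ.suc-injective len , q)
          (Both-Reach opt Subset.⊥ (λ u∈ e _ → closed u∈ e impossible)
             (missed opt (v ∷ w ∷ D) len q (here refl)) (Components.sameComp⇒Reach G Subset.⊥ (connected v w)))

    -- Recursion on the deficiency, which every raise lowers by one.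
    grow : ∀ j P → Opt P j → (∀ x → cnt x P ≤ 1) → Saturated j P → Outcome
    grow zero P (([] , _ , q) , _) cnt≤1 sat = full q cnt≤1 (λ x∉ → sat x∉ [] z≤n)
    grow (suc j) P opt cnt≤1 sat with any? (λ y → Boundary? j P y ×-dec ¬? (cnt y P ℕ.≟ 0))
    ... | no ¬raisable = everywhere opt cnt≤1 sat raised
      where
      raised : ∀ {y} → Boundary j P y → cnt y P ≡ 0
      raised {y} b with cnt y P ℕ.≟ 0
      ... | yes eq = eq
      ... | no neq = contradiction (y , b , neq) ¬raisable
    ... | yes (y , b , y∈) with P′ , p ← ∈⇒↭ (cnt≢0⇒∈ P y∈) = grow j P′ opt′ cnt≤1′ saturated′
      where open Raise opt cnt≤1 sat b p

    initial : Misses (length (spread (λ x → f x ∸ 1) (allFin n))) (allFin n)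
    initial = D , refl , [] , covers cover
      where
      D : List V
      D = spread (λ x → f x ∸ 1) (allFin n)

      cover : ∀ x → cnt x (D ++ allFin n) ≡ f x
      cover x = trans (cnt-++ x D (allFin n)) (trans (cong₂ _+_ (cnt-spread (λ x → f x ∸ 1) x) (cnt-allFin x))
        (m∸n+n≡m (0<f x)))

    outcome : Outcome
    outcome with Opt-exists initial
    ... | j , opt = grow j (allFin n) opt (λ x → ≤-reflexive (cnt-allFin x))
      -- Every vertex starts in `P`, so saturation holds vacuously.
      (λ {x} x∉ → contradiction (trans (≡.sym (cnt-allFin x)) x∉) 1+n≢0)

-- Symmetric difference of a graph with one edge.

module Toggle {n : ℕ} (F : Graph n) {u v : Fin n} (u≢v : u ≢ v) where

  isEdge : Fin n → Fin n → Bool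
  isEdge a b = (⌊ u ≟ a ⌋ ∧ ⌊ v ≟ b ⌋) ∨ (⌊ v ≟ a ⌋ ∧ ⌊ u ≟ b ⌋)

  isEdge-sym : ∀ a b → isEdge a b ≡ isEdge b a
  isEdge-sym a b = trans (∨-comm (⌊ u ≟ a ⌋ ∧ ⌊ v ≟ b ⌋) _)
    (cong₂ _∨_ (∧-comm ⌊ v ≟ a ⌋ _) (∧-comm ⌊ u ≟ a ⌋ _))

  isEdge-true : ∀ a b → isEdge a b ≡ true → (a ≡ u × b ≡ v) ⊎ (a ≡ v × b ≡ u)
  isEdge-true a b eq with ∨-true (⌊ u ≟ a ⌋ ∧ ⌊ v ≟ b ⌋) eq
  ... | inj₁ e with p , q ← ∧-true ⌊ u ≟ a ⌋ e = inj₁ (≡.sym (≟-true p) , ≡.sym (≟-true q))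
  ... | inj₂ e with p , q ← ∧-true ⌊ v ≟ a ⌋ e = inj₂ (≡.sym (≟-true p) , ≡.sym (≟-true q))

  isEdge-irr : ∀ a → isEdge a a ≡ false
  isEdge-irr a with isEdge a a in eq
  ... | false = refl
  ... | true with isEdge-true a a eq
  ...   | inj₁ (refl , a≡v) = contradiction a≡v u≢v
  ...   | inj₂ (refl , a≡u) = contradiction (≡.sym a≡u) u≢v

  adj-isEdge : ∀ a b → isEdge a b ≡ true → adj F a b ≡ adj F u v
  adj-isEdge a b eq with isEdge-true a b eq
  ... | inj₁ (refl , refl) = refl
  ... | inj₂ (refl , refl) = Graph.sym F v u

  toggle : Graph n
  toggle = record
    { adj = λ a b → adj F a b xor isEdge a b
    ; sym = λ a b → cong₂ _xor_ (Graph.sym F a b) (isEdge-sym a b)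
    ; irr = λ a → cong₂ _xor_ (Graph.irr F a) (isEdge-irr a)
    }

  count-isEdge : ∀ a → countV (isEdge a) ≡ δ u a + δ v a
  count-isEdge a = trans (Σv-cong indicator) (trans (Σv-+ (λ b → δ u a * δ v b) _) (cong₂ _+_ (single u v) (single v u)))
    where
    indicator : ∀ b → ι (isEdge a b) ≡ δ u a * δ v b + δ v a * δ u b
    indicator b with u ≟ a | v ≟ a
    ... | yes refl | yes refl = contradiction refl u≢v
    ... | no _     | no _     = refl
    ... | no _     | yes _    = ≡.sym (+-identityʳ _)
    ... | yes _    | no _ with v ≟ b
    ...   | yes _ = refl
    ...   | no _  = refl

    single : ∀ s t → Σv (λ b → δ s a * δ t b) ≡ δ s a
    single s t = trans (Σv-only t _ (λ b t≢b → trans (cong (δ s a *_) (δ-≢ t≢b)) (*-zeroʳ (δ s a))))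
      (trans (cong (δ s a *_) (δ-refl t)) (*-identityʳ _))

  private
    rearr : ∀ a b c → c + (a + b) ≡ a + (b + c)
    rearr = solve-∀

  deg-toggle⁺ : adj F u v ≡ false → ∀ x → deg toggle x ≡ δ u x + (δ v x + deg F x)
  deg-toggle⁺ uv∉ x = trans (Σv-cong pointwise) (trans (Σv-+ (λ b → ι (adj F x b)) _)
    (trans (cong (deg F x +_) (count-isEdge x)) (rearr (δ u x) (δ v x) (deg F x))))
    where
    pointwise : ∀ b → ι (adj F x b xor isEdge x b) ≡ ι (adj F x b) + ι (isEdge x b)
    pointwise b with adj F x b in e | isEdge x b in e′
    ... | true  | false = refl
    ... | false | true  = refl
    ... | false | false = refl
    ... | true  | true with () ← trans (≡.sym e) (trans (adj-isEdge x b e′) uv∉)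

  deg-toggle⁻ : adj F u v ≡ true → ∀ x → deg F x ≡ δ u x + (δ v x + deg toggle x)
  deg-toggle⁻ uv∈ x = trans (Σv-cong pointwise) (trans (Σv-+ (λ b → ι (adj toggle x b)) _)
    (trans (cong (deg toggle x +_) (count-isEdge x)) (rearr (δ u x) (δ v x) (deg toggle x))))
    where
    pointwise : ∀ b → ι (adj F x b) ≡ ι (adj F x b xor isEdge x b) + ι (isEdge x b)
    pointwise b with adj F x b in e | isEdge x b in e′
    ... | true  | false = refl
    ... | true  | true  = refl
    ... | false | false = refl
    ... | false | true with () ← trans (≡.sym e) (trans (adj-isEdge x b e′) uv∈)

  toggle-sub : ∀ {G} → SpanningSub F G → adj G u v ≡ true → SpanningSub toggle G
  toggle-sub {G} sub uv∈ a b e with adj F a b in e₁ | isEdge a b in e₂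
  ... | true  | _    = sub a b e₁
  ... | false | true with isEdge-true a b e₂
  ...   | inj₁ (refl , refl) = uv∈
  ...   | inj₂ (refl , refl) = trans (Graph.sym G v u) uv∈

-- From multigraph realisations to factors.

module Factor {n : ℕ} (G : Graph n) (f : Fin n → ℕ)
              (f-even : ∀ v → 2 ∣ f v) (1<f : ∀ v → 1 < f v) where

  open Deficiency G f f-even 1<f

  -- Reduction modulo 2 of a multigraph E: the graph F and the list K of the cancelled loops and
  -- parallel pairs, each of which can be traded for two units of degree at one vertex.
  record Reduction (E : List Edge) : Set where
    field
      F       : Graph n
      sub     : SpanningSub F G
      K       : List V
      degrees : ∀ x → edeg x E ≡ deg F x + (cnt x K + cnt x K)
      excess  : ∀ {x} → x ∈ K → ∃ λ E′ → ∀ y → edeg y E ≡ δ x y + (δ x y + edeg y E′)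
      present : ∀ {u v} → adj F u v ≡ true → ∃ λ E′ → ∀ y → edeg y E ≡ δ u y + (δ v y + edeg y E′)

  emptyGraph : Graph n
  emptyGraph = record { adj = λ _ _ → false ; sym = λ _ _ → refl ; irr = λ _ → refl }

  -- A loop goes to `K`; a new edge is toggled into `F`; a second copy of an edge toggles it out and
  -- sends both ends to `K`.
  reduce : ∀ E → Reduction E
  reduce [] = record
    { F = emptyGraph ; sub = λ _ _ () ; K = []
    ; degrees = λ x → ≡.sym (trans (+-identityʳ _) (Σv-0 {n} (λ _ → refl)))
    ; excess = λ () ; present = λ () }
  reduce (edge {u} {v} uv ∷ E) = cases uv
    where
    open Reduction (reduce E)

    past : ∀ {a b E′} → (∀ y → edeg y E ≡ δ a y + (δ b y + edeg y E′)) →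
      ∀ y → δ u y + (δ v y + edeg y E) ≡ δ a y + (δ b y + edeg y (edge uv ∷ E′))
    past {a} {b} {E′} eq y = trans (cong (λ e → δ u y + (δ v y + e)) (eq y))
      (rearr (δ u y) (δ v y) (δ a y) (δ b y) (edeg y E′))
      where
      rearr : ∀ a b c d e → a + (b + (c + (d + e))) ≡ c + (d + (a + (b + e)))
      rearr = solve-∀

    excess′ : ∀ {x} → x ∈ K → ∃ λ E′ → ∀ y → edeg y (edge uv ∷ E) ≡ δ x y + (δ x y + edeg y E′)
    excess′ {x} x∈ with E′ , eq ← excess x∈ = edge uv ∷ E′ , past {x} {x} {E′} eq

    present′ : ∀ {a b} → adj F a b ≡ true → ∃ λ E′ → ∀ y → edeg y (edge uv ∷ E) ≡ δ a y + (δ b y + edeg y E′)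
    present′ {a} {b} ab∈ with E′ , eq ← present ab∈ = edge uv ∷ E′ , past {a} {b} {E′} eq

    cases : Joined u v → Reduction (edge uv ∷ E)
    cases (inj₁ refl) = record
      { F = F ; sub = sub ; K = u ∷ K
      ; degrees = λ x → trans (cong (λ e → δ u x + (δ u x + e)) (degrees x)) (rearr (δ u x) (deg F x) (cnt x K))
      ; excess = λ { (here refl) → E , λ _ → refl ; (there x∈) → excess′ x∈ }
      ; present = present′ }
      where
      rearr : ∀ a d c → a + (a + (d + (c + c))) ≡ d + (a + c + (a + c))
      rearr = solve-∀
    cases (inj₂ e) with adj F u v in uv∈?
    ... | false = record
      { F = toggle ; sub = toggle-sub {G} sub e ; K = K
      ; degrees = λ x → trans (cong (λ e → δ u x + (δ v x + e)) (degrees x))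
          (trans (rearr (δ u x) (δ v x) (deg F x) (cnt x K + cnt x K))
                 (cong (_+ (cnt x K + cnt x K)) (≡.sym (deg-toggle⁺ uv∈? x))))
      ; excess = excess′
      ; present = present″ }
      where
      u≢v : u ≢ v
      u≢v refl with () ← trans (≡.sym e) (Graph.irr G u)

      open Toggle F u≢v

      rearr : ∀ a b d c → a + (b + (d + c)) ≡ a + (b + d) + c
      rearr = solve-∀

      present″ : ∀ {a b} → adj toggle a b ≡ true → ∃ λ E′ → ∀ y → edeg y (edge uv ∷ E) ≡ δ a y + (δ b y + edeg y E′)
      present″ {a} {b} ab∈ with adj F a b in e₁ | isEdge a b in e₂
      ... | true  | _    = present′ e₁
      ... | false | true with isEdge-true a b e₂
      ...   | inj₁ (refl , refl) = E , λ _ → refl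
      ...   | inj₂ (refl , refl) = E , λ y → swapped (δ u y) (δ v y) (edeg y E)
        where
        swapped : ∀ a b c → a + (b + c) ≡ b + (a + c)
        swapped = solve-∀
    ... | true = record
      { F = toggle ; sub = toggle-sub {G} sub e ; K = u ∷ v ∷ K
      ; degrees = λ x → trans (cong (λ e → δ u x + (δ v x + e)) (degrees x))
          (trans (cong (λ d → δ u x + (δ v x + (d + (cnt x K + cnt x K)))) (deg-toggle⁻ uv∈? x))
                 (rearr (δ u x) (δ v x) (deg toggle x) (cnt x K)))
      ; excess = excess″
      ; present = present″ }
      where
      u≢v : u ≢ v
      u≢v refl with () ← trans (≡.sym e) (Graph.irr G u)

      open Toggle F u≢v

      rearr : ∀ a b d c → a + (b + (a + (b + d) + (c + c))) ≡ d + (a + (b + c) + (a + (b + c)))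
      rearr = solve-∀

      excess″ : ∀ {x} → x ∈ u ∷ v ∷ K → ∃ λ E′ → ∀ y → edeg y (edge uv ∷ E) ≡ δ x y + (δ x y + edeg y E′)
      -- The parallel pair `uv` is traded for a loop at `v`, which frees two units at `u`.
      excess″ (here refl) with E′ , eq ← present uv∈? = edge {v} {v} (inj₁ refl) ∷ E′ , λ y →
        trans (cong (λ e → δ u y + (δ v y + e)) (eq y)) (rearr′ (δ u y) (δ v y) (edeg y E′))
        where
        rearr′ : ∀ a b c → a + (b + (a + (b + c))) ≡ a + (a + (b + (b + c)))
        rearr′ = solve-∀
      excess″ (there (here refl)) with E′ , eq ← present uv∈? = edge {u} {u} (inj₁ refl) ∷ E′ , λ y →
        trans (cong (λ e → δ u y + (δ v y + e)) (eq y)) (rearr′ (δ u y) (δ v y) (edeg y E′))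
        where
        rearr′ : ∀ a b c → a + (b + (a + (b + c))) ≡ b + (b + (a + (a + c)))
        rearr′ = solve-∀
      excess″ (there (there x∈)) = excess′ x∈

      present″ : ∀ {a b} → adj toggle a b ≡ true → ∃ λ E′ → ∀ y → edeg y (edge uv ∷ E) ≡ δ a y + (δ b y + edeg y E′)
      present″ {a} {b} ab∈ with adj F a b in e₁ | isEdge a b in e₂
      ... | true  | false = present′ e₁
      ... | false | true with () ← trans (≡.sym e₁) (trans (adj-isEdge a b e₂) uv∈?)

  2∣m+m : ∀ m → 2 ∣ m + m
  2∣m+m m = subst (2 ∣_) (cong (m +_) (+-identityʳ m)) (m∣m*n m)

  module _ {Q : List V} (q : N Q) where

    open Reduction (reduce (proj₁ q)) public

    degree-sum : ∀ x → cnt x K + cnt x K + (deg F x + cnt x Q) ≡ f x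
    degree-sum x = trans (rearr (cnt x K + cnt x K) (deg F x) (cnt x Q))
      (trans (cong (_+ cnt x Q) (≡.sym (degrees x))) (at (proj₂ q) x))
      where
      rearr : ∀ c d e → c + (d + e) ≡ d + c + e
      rearr = solve-∀

    deg+cnt-even : ∀ x → 2 ∣ deg F x + cnt x Q
    deg+cnt-even x = ∣m+n∣m⇒∣n (subst (2 ∣_) (≡.sym (degree-sum x)) (f-even x)) (2∣m+m (cnt x K))

    deg+cnt≤f : ∀ x → deg F x + cnt x Q ≤ f x
    deg+cnt≤f x = subst (deg F x + cnt x Q ≤_) (degree-sum x) (m≤n+m _ (cnt x K + cnt x K))

    -- If `x` were in `K`, two units could be dropped at `x`, against `sat`; so nothing was
    -- cancelled at `x`.
    saturated-deg : ∀ {x} → cnt x Q ≡ 0 → ¬ N (x ∷ x ∷ Q) → deg F x ≡ f x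
    saturated-deg {x} x∉Q sat with ∈-split x K
    ... | inj₁ x∉K = trans (rearr (deg F x)) (trans (cong₂ (λ k c → k + k + (deg F x + c)) (≡.sym x∉K) (≡.sym x∉Q)) (degree-sum x))
      where
      rearr : ∀ d → d ≡ 0 + 0 + (d + 0)
      rearr = solve-∀
    ... | inj₂ (K′ , p) with E′ , eq ← excess (∈-resp-↭ (↭-sym p) (here refl)) =
      contradiction (E′ , covers λ y → trans (rearr (edeg y E′) (δ x y) (cnt y Q))
                            (trans (cong (_+ cnt y Q) (≡.sym (eq y))) (at (proj₂ q) y))) sat
      where
      rearr : ∀ e d c → e + (d + (d + c)) ≡ d + (d + e) + c
      rearr = solve-∀

  odd⇒InHf : ∀ {x d} → 2 ∣ suc d → suc d ≤ f x → InHf (f x) d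
  odd⇒InHf even le = inj₁ (even-suc⇒odd even , ∸-monoˡ-≤ 1 le)

  -- At a vertex of `P` the degree has the parity of `f − 1` and is at most `f − 1`; outside `P`
  -- saturation makes it `f`.
  full-factor : ∀ {P} → N P → (∀ x → cnt x P ≤ 1) → (∀ {x} → cnt x P ≡ 0 → ¬ N (x ∷ x ∷ P)) →
    Σ (Graph n) (HfFactor G f)
  full-factor {P} q cnt≤1 sat = F q , sub q , degree
    where
    degree : ∀ x → InHf (f x) (deg (F q) x)
    degree x with cnt x P in eq | cnt≤1 x
    ... | zero        | _ = inj₂ (saturated-deg q eq (sat eq))
    ... | suc (suc _) | s≤s ()
    ... | suc zero    | _ = odd⇒InHf (subst (2 ∣_) deg+1 (deg+cnt-even q x)) (subst (_≤ f x) deg+1 (deg+cnt≤f q x))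
      where
      deg+1 : deg (F q) x + cnt x P ≡ suc (deg (F q) x)
      deg+1 = trans (cong (deg (F q) x +_) eq) (+-comm _ 1)

  -- Repairing the last bad vertex.

  module _ (min-deg : ∀ v → f v ∸ 1 ≤ deg G v) where

    -- All degrees are odd and at most `f − 1`, except an even one below `f x` at `x`; successors
    -- replace the subtraction.
    record NearFactor (F : Graph n) (x : V) : Set where
      field
        spanning : SpanningSub F G
        even   : 2 ∣ deg F x
        small  : deg F x < f x
        others : ∀ {y} → x ≢ y → 2 ∣ suc (deg F y) × suc (deg F y) ≤ f y

    near-degree≤f : ∀ {F x} → NearFactor F x → ∀ y → deg F y ≤ f y
    near-degree≤f {F} {x} nf y with x ≟ y
    ... | yes refl = <⇒≤ (NearFactor.small nf)
    ... | no x≢y   = <⇒≤ (proj₂ (NearFactor.others nf x≢y))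

    even-gap : ∀ {d m} → 2 ∣ d → 2 ∣ m → d < m → suc d < m
    even-gap {d} 2∣d 2∣m d<m = ≤∧≢⇒< d<m λ { refl →
      contradiction (∣⇒≤ (∣m+n∣m⇒∣n (subst (2 ∣_) (+-comm 1 d) 2∣m) 2∣d)) λ { (s≤s ()) } }

    -- Adding an unused edge at the bad vertex x repairs x; its other end becomes full or the new bad vertex.
    improve : ∀ k F x → NearFactor F x → Σv f ≤ Σv (deg F) + k → Σ (Graph n) (HfFactor G f)
    improve k F x nf room with any? (λ y → (adj G x y Bool.≟ true) ×-dec (adj F x y Bool.≟ false))
    -- If `F` used every edge at `x`, then `deg G x` would be at most `f x − 2` by parity, against
    -- the minimum degree.
    ... | no ¬free = contradiction (Σv-mono (λ y → ι-mono (used y)))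
            (<⇒≱ (<-≤-trans (∸-monoˡ-≤ 1 (even-gap even (f-even x) small)) (min-deg x)))
      where
      open NearFactor nf

      used : ∀ y → adj G x y ≡ true → adj F x y ≡ true
      used y xy∈ with adj F x y in eq
      ... | true  = refl
      ... | false = contradiction (y , xy∈ , eq) ¬free
    ... | yes (y , xy∈ , xy∉) = continue k room
      where
      open NearFactor nf

      x≢y : x ≢ y
      x≢y refl with () ← trans (≡.sym xy∈) (Graph.irr G x)

      open Toggle F x≢y

      deg-x : deg toggle x ≡ suc (deg F x)
      deg-x = trans (deg-toggle⁺ xy∉ x) (cong₂ _+_ (δ-refl x) (cong (_+ deg F x) (δ-≢ (x≢y ∘ ≡.sym))))

      deg-y : deg toggle y ≡ suc (deg F y)
      deg-y = trans (deg-toggle⁺ xy∉ y) (cong₂ _+_ (δ-≢ x≢y) (cong (_+ deg F y) (δ-refl y)))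

      deg-z : ∀ {z} → x ≢ z → y ≢ z → deg toggle z ≡ deg F z
      deg-z {z} x≢z y≢z = trans (deg-toggle⁺ xy∉ z) (cong₂ _+_ (δ-≢ x≢z) (cong (_+ deg F z) (δ-≢ y≢z)))

      others′ : ∀ {z} → y ≢ z → 2 ∣ suc (deg toggle z) × suc (deg toggle z) ≤ f z
      others′ {z} y≢z = by-cases (x ≟ z)
        where
        Good : ℕ → Set
        Good d = 2 ∣ suc d × suc d ≤ f z

        by-cases : Dec (x ≡ z) → Good (deg toggle z)
        by-cases (yes refl) = subst Good (≡.sym deg-x)
          (∣m∣n⇒∣m+n (∣-reflexive {2} refl) even , even-gap even (f-even x) small)
        by-cases (no x≢z) = subst Good (≡.sym (deg-z x≢z y≢z)) (others x≢z)

      continue : ∀ k → Σv f ≤ Σv (deg F) + k → Σ (Graph n) (HfFactor G f)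
      -- `k` bounds the total gap between `f` and the degrees, and the gap at `x` is positive.
      continue zero room = contradiction (subst (Σv f ≤_) (+-identityʳ _) room)
        (<⇒≱ (Σv-strict (near-degree≤f nf) x small))
      continue (suc k) room with deg toggle y ℕ.≟ f y
      ... | no ≢f = improve k toggle y
              (record { spanning = toggle-sub {G} spanning xy∈
                      ; even   = subst (2 ∣_) (≡.sym deg-y) (proj₁ (others x≢y))
                      ; small  = ≤∧≢⇒< (subst (_≤ f y) (≡.sym deg-y) (proj₂ (others x≢y))) ≢f
                      ; others = others′ })
              (≤-trans room (subst (_≤ Σv (deg toggle) + k) (≡.sym (+-suc _ k)) (+-monoˡ-≤ k more)))
        where
        more : Σv (deg F) < Σv (deg toggle)
        more = Σv-strict (λ z → subst (deg F z ≤_) (≡.sym (deg-toggle⁺ xy∉ z))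
                 (≤-trans (m≤n+m _ (δ y z)) (m≤n+m _ (δ x z)))) x (≤-reflexive (≡.sym deg-x))
      ... | yes ≡f = toggle , toggle-sub {G} spanning xy∈ , λ z → degree z (y ≟ z)
        where
        degree : ∀ z → Dec (y ≡ z) → InHf (f z) (deg toggle z)
        degree z (yes refl) = inj₂ ≡f
        degree z (no y≢z) with even′ , le ← others′ y≢z = odd⇒InHf even′ le

    -- `x ∷ P` contains `x` twice and every other vertex once, so reduction modulo 2 gives an even
    -- degree at `x` only.
    near-factor : ∀ {x P} → N (x ∷ P) → (∀ y → cnt y P ≡ 1) → Σ (Graph n) (HfFactor G f)
    near-factor {x} {P} q ones = improve (Σv f) (F q) x
      (record { spanning = sub q
              ; even   = ∣m+n∣m⇒∣n (subst (2 ∣_) deg+2 (deg+cnt-even q x)) (∣-reflexive {2} refl)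
              ; small  = ≤-trans (n≤1+n _) (subst (_≤ f x) deg+2 (deg+cnt≤f q x))
              ; others = λ {y} x≢y → subst (2 ∣_) (deg+1 x≢y) (deg+cnt-even q y) ,
                                     subst (_≤ f y) (deg+1 x≢y) (deg+cnt≤f q y) })
      (m≤n+m _ _)
      where
      deg+2 : deg (F q) x + cnt x (x ∷ P) ≡ 2 + deg (F q) x
      deg+2 = trans (cong (deg (F q) x +_) (cong₂ _+_ (δ-refl x) (ones x))) (+-comm _ 2)

      deg+1 : ∀ {y} → x ≢ y → deg (F q) y + cnt y (x ∷ P) ≡ suc (deg (F q) y)
      deg+1 {y} x≢y = trans (cong (deg (F q) y +_) (cong₂ _+_ (δ-≢ x≢y) (ones y))) (+-comm _ 1)

theorem6 : (n : ℕ) → (G : Graph n) → Connected G → n % 2 ≡ 1 →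
    (f : Fin n → ℕ) → (∀ v → f v % 2 ≡ 0) → (∀ v → 4 ≤ f v) →
    (∀ v → f v ∸ 1 ≤ deg G v) →
    (∀ (S : Subset n) → Nonempty S → oddComps G S ≤ fSum f S) →
    Σ (Graph n) (λ F → HfFactor G f F)
theorem6 n G connected _ f f-even 4≤f min-deg tough = conclude outcome
  where
  2∣f : ∀ v → 2 ∣ f v
  2∣f v = m%n≡0⇒n∣m (f v) 2 (f-even v)

  1<f : ∀ v → 1 < f v
  1<f v = ≤-trans (s≤s (s≤s z≤n)) (4≤f v)

  open Factor G f 2∣f 1<f
  open Deficiency.Completion G f 2∣f 1<f connected tough

  conclude : Outcome → Σ (Graph n) (λ F → HfFactor G f F)
  conclude (full q cnt≤1 sat) = full-factor q cnt≤1 sat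
  conclude (near q ones)      = near-factor min-deg q ones
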